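{- The theory $\mathsf{KP}^{\mathcal{P}}$ proves every instance of $\Sigma_1^{\mathcal{P}}$-$\mathsf{Foundation}$; that is, $\mathsf{KP}^{\mathcal{P}} \vdash \Sigma_1^{\mathcal{P}}\text{ - }\mathsf{Foundation}$.
   Context: All formulae are in the language $\mathcal{L}=\{\in,=\}$ of set theory, in classical first-order logic. Formula classes. $\Delta_0$: smallest class closed under propositional connectives and bounded quantification $\exists x\in y$, $\forall x\in y$. $\Delta_0^{\mathcal{P}}$: smallest class of $\mathcal{L}$-formulae closed under propositional connectives and quantification of the forms $\mathcal{Q}x\in y$ and $\mathcal{Q}x\subseteq y$, where $\mathcal{Q}\in\{\exists,\forall\}$ and $x,y$ are distinct variables. $\Sigma_1^{\mathcal{P}}$ (resp. $\Pi_1^{\mathcal{P}}$) formulae are those obtained from $\Delta_0^{\mathcal{P}}$ formulae by prefixing unbounded existential (resp. universal) quantifiers. Schemes, for a class $\Gamma$ of formulae. $\Gamma$-Separation: for $\phi(x,\vec z)\in\Gamma$, $\forall\vec z\forall w\exists y\forall x(x\in y\iff x\in w\wedge\phi(x,\vec z))$. $\Gamma$-Collection: for $\phi(x,y,\vec z)\in\Gamma$, $\forall\vec z\forall w((\forall x\in w)\exists y\,\phi\Rightarrow\exists C(\forall x\in w)(\exists y\in C)\phi)$. $\Gamma$-Foundation: for $\phi(x,\vec z)\in\Gamma$, $\forall\vec z(\exists x\,\phi(x,\vec z)\Rightarrow\exists y(\phi(y,\vec z)\wedge(\forall x\in y)\neg\phi(x,\vec z)))$. Set-foundation is $\Gamma$-Foundation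 for $\Gamma=\{x\in z\}$. Theories. $\mathsf{M}$: Extensionality, Emptyset, Pair, Union, Set difference ($x\setminus y$ exists), Powerset, $\mathsf{TCo}$ (every set is contained in a transitive set), Infinity, $\Delta_0$-Separation, Set-foundation. $\mathsf{KP}^{\mathcal{P}}$: $\mathsf{M}$ plus $\Delta_0^{\mathcal{P}}$-Collection plus $\Pi_1^{\mathcal{P}}$-Foundation. (The axiom of choice is not included.) -}

module Defs where

open import Data.Fin using (Fin; zero; suc; lift)
open import Data.Fin.Patterns using (0F; 1F; 2F; 3F)
open import Data.List using (List; []; _∷_; map)
open import Data.List.Membership.Propositional using () renaming (_∈_ to _∈ˡ_)
open import Data.Nat using (ℕ; zero; suc)
open import Data.Vec.Functional using () renaming (_∷_ to _∷ᶠ_)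
open import Function using (id)
open import Level using (0ℓ)
open import Relation.Unary using (Pred; _∪_)

infix  8 _∈_ _≐_ _⊆_ _∉_
infix  7 ¬_
infixr 6 _∧_
infixr 5 _∨_
infixr 4 _⇒_
infix  3 _⇔_
infix  2 ∀′_ ∃′_ ∀∈[_]_ ∃∈[_]_ ∀⊆[_]_ ∃⊆[_]_

-- Formulae of {∈,=} with free variables in Fin n (de Bruijn indices; index 0 is
-- the innermost bound variable).  The language has no function symbols, so
-- variables are the only terms.
data Formula : ℕ → Set where
  _∈_ _≐_     : ∀ {n} → Fin n → Fin n → Formula n
  ⊥           : ∀ {n} → Formula n
  _∧_ _∨_ _⇒_ : ∀ {n} → Formula n → Formula n → Formula n
  ∀′_ ∃′_     : ∀ {n} → Formula (suc n) → Formula n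

Sentence : Set
Sentence = Formula 0

¬_ : ∀ {n} → Formula n → Formula n
¬ φ = φ ⇒ ⊥

_⇔_ : ∀ {n} → Formula n → Formula n → Formula n
φ ⇔ ψ = (φ ⇒ ψ) ∧ (ψ ⇒ φ)

_∉_ : ∀ {n} → Fin n → Fin n → Formula n
x ∉ y = ¬ (x ∈ y)

_⊆_ : ∀ {n} → Fin n → Fin n → Formula n
x ⊆ y = ∀′ (0F ∈ suc x ⇒ 0F ∈ suc y)

-- The bound y lives outside the scope of the quantified variable, so the two
-- are automatically distinct.
∀∈[_]_ ∃∈[_]_ ∀⊆[_]_ ∃⊆[_]_ : ∀ {n} → Fin n → Formula (suc n) → Formula n
∀∈[ y ] φ = ∀′ (0F ∈ suc y ⇒ φ)
∃∈[ y ] φ = ∃′ (0F ∈ suc y ∧ φ)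
∀⊆[ y ] φ = ∀′ (0F ⊆ suc y ⇒ φ)
∃⊆[ y ] φ = ∃′ (0F ⊆ suc y ∧ φ)

rename : ∀ {m n} → (Fin m → Fin n) → Formula m → Formula n
rename ρ (x ∈ y) = ρ x ∈ ρ y
rename ρ (x ≐ y) = ρ x ≐ ρ y
rename ρ ⊥       = ⊥
rename ρ (φ ∧ ψ) = rename ρ φ ∧ rename ρ ψ
rename ρ (φ ∨ ψ) = rename ρ φ ∨ rename ρ ψ
rename ρ (φ ⇒ ψ) = rename ρ φ ⇒ rename ρ ψ
rename ρ (∀′ φ)  = ∀′ rename (lift 1 ρ) φ
rename ρ (∃′ φ)  = ∃′ rename (lift 1 ρ) φ

weaken : ∀ {n} → Formula n → Formula (suc n)
weaken = rename suc

-- Substitution of t for variable 0.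
_[_] : ∀ {n} → Formula (suc n) → Fin n → Formula n
φ [ t ] = rename (t ∷ᶠ id) φ

closure : ∀ n → Formula n → Sentence
closure zero    φ = φ
closure (suc n) φ = closure n (∀′ φ)

Theory : Set₁
Theory = Pred Sentence 0ℓ

infix 1 _∣_⊢_ _⊢_

-- Classical natural deduction with equality.  The axioms of T are closed, so
-- they do not interfere with the eigenvariable conditions, which are expressed
-- by weakening.
data _∣_⊢_ (T : Theory) : ∀ {n} → List (Formula n) → Formula n → Set where
  axiom : ∀ {n} {Γ : List (Formula n)} {σ} → T σ → T ∣ Γ ⊢ rename (λ ()) σ
  hyp   : ∀ {n} {Γ : List (Formula n)} {φ} → φ ∈ˡ Γ → T ∣ Γ ⊢ φ
  raa   : ∀ {n} {Γ : List (Formula n)} {φ} → T ∣ ¬ φ ∷ Γ ⊢ ⊥ → T ∣ Γ ⊢ φ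
  ∧I    : ∀ {n} {Γ : List (Formula n)} {φ ψ} →
          T ∣ Γ ⊢ φ → T ∣ Γ ⊢ ψ → T ∣ Γ ⊢ φ ∧ ψ
  ∧E₁   : ∀ {n} {Γ : List (Formula n)} {φ ψ} → T ∣ Γ ⊢ φ ∧ ψ → T ∣ Γ ⊢ φ
  ∧E₂   : ∀ {n} {Γ : List (Formula n)} {φ ψ} → T ∣ Γ ⊢ φ ∧ ψ → T ∣ Γ ⊢ ψ
  ∨I₁   : ∀ {n} {Γ : List (Formula n)} {φ ψ} → T ∣ Γ ⊢ φ → T ∣ Γ ⊢ φ ∨ ψ
  ∨I₂   : ∀ {n} {Γ : List (Formula n)} {φ ψ} → T ∣ Γ ⊢ ψ → T ∣ Γ ⊢ φ ∨ ψ
  ∨E    : ∀ {n} {Γ : List (Formula n)} {φ ψ χ} →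
          T ∣ Γ ⊢ φ ∨ ψ → T ∣ φ ∷ Γ ⊢ χ → T ∣ ψ ∷ Γ ⊢ χ → T ∣ Γ ⊢ χ
  ⇒I    : ∀ {n} {Γ : List (Formula n)} {φ ψ} → T ∣ φ ∷ Γ ⊢ ψ → T ∣ Γ ⊢ φ ⇒ ψ
  ⇒E    : ∀ {n} {Γ : List (Formula n)} {φ ψ} →
          T ∣ Γ ⊢ φ ⇒ ψ → T ∣ Γ ⊢ φ → T ∣ Γ ⊢ ψ
  ∀I    : ∀ {n} {Γ : List (Formula n)} {φ} →
          T ∣ map weaken Γ ⊢ φ → T ∣ Γ ⊢ ∀′ φ
  ∀E    : ∀ {n} {Γ : List (Formula n)} {φ} →
          T ∣ Γ ⊢ ∀′ φ → (t : Fin n) → T ∣ Γ ⊢ φ [ t ]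
  ∃I    : ∀ {n} {Γ : List (Formula n)} {φ} (t : Fin n) →
          T ∣ Γ ⊢ φ [ t ] → T ∣ Γ ⊢ ∃′ φ
  ∃E    : ∀ {n} {Γ : List (Formula n)} {φ χ} →
          T ∣ Γ ⊢ ∃′ φ → T ∣ φ ∷ map weaken Γ ⊢ weaken χ → T ∣ Γ ⊢ χ
  ≐refl : ∀ {n} {Γ : List (Formula n)} (t : Fin n) → T ∣ Γ ⊢ t ≐ t
  ≐sub  : ∀ {n} {Γ : List (Formula n)} {s t} (φ : Formula (suc n)) →
          T ∣ Γ ⊢ s ≐ t → T ∣ Γ ⊢ φ [ s ] → T ∣ Γ ⊢ φ [ t ]
  -- Domains are nonempty; with scoped variables and no constants this does not
  -- follow from the other rules when n = 0.
  inhab : ∀ {n} {Γ : List (Formula n)} → T ∣ Γ ⊢ ∃′ (0F ≐ 0F)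

_⊢_ : Theory → Sentence → Set
T ⊢ σ = T ∣ [] ⊢ σ

Class : Set₁
Class = ∀ {n} → Formula n → Set

data Δ₀ : Class where
  mem : ∀ {n} (x y : Fin n) → Δ₀ (x ∈ y)
  eq  : ∀ {n} (x y : Fin n) → Δ₀ (x ≐ y)
  bot : ∀ {n} → Δ₀ (⊥ {n})
  and : ∀ {n} {φ ψ : Formula n} → Δ₀ φ → Δ₀ ψ → Δ₀ (φ ∧ ψ)
  or  : ∀ {n} {φ ψ : Formula n} → Δ₀ φ → Δ₀ ψ → Δ₀ (φ ∨ ψ)
  imp : ∀ {n} {φ ψ : Formula n} → Δ₀ φ → Δ₀ ψ → Δ₀ (φ ⇒ ψ)
  ∀∈  : ∀ {n} (y : Fin n) {φ : Formula (suc n)} → Δ₀ φ → Δ₀ (∀∈[ y ] φ)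
  ∃∈  : ∀ {n} (y : Fin n) {φ : Formula (suc n)} → Δ₀ φ → Δ₀ (∃∈[ y ] φ)

data Δ₀ᴾ : Class where
  mem : ∀ {n} (x y : Fin n) → Δ₀ᴾ (x ∈ y)
  eq  : ∀ {n} (x y : Fin n) → Δ₀ᴾ (x ≐ y)
  bot : ∀ {n} → Δ₀ᴾ (⊥ {n})
  and : ∀ {n} {φ ψ : Formula n} → Δ₀ᴾ φ → Δ₀ᴾ ψ → Δ₀ᴾ (φ ∧ ψ)
  or  : ∀ {n} {φ ψ : Formula n} → Δ₀ᴾ φ → Δ₀ᴾ ψ → Δ₀ᴾ (φ ∨ ψ)
  imp : ∀ {n} {φ ψ : Formula n} → Δ₀ᴾ φ → Δ₀ᴾ ψ → Δ₀ᴾ (φ ⇒ ψ)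
  ∀∈  : ∀ {n} (y : Fin n) {φ : Formula (suc n)} → Δ₀ᴾ φ → Δ₀ᴾ (∀∈[ y ] φ)
  ∃∈  : ∀ {n} (y : Fin n) {φ : Formula (suc n)} → Δ₀ᴾ φ → Δ₀ᴾ (∃∈[ y ] φ)
  ∀⊆  : ∀ {n} (y : Fin n) {φ : Formula (suc n)} → Δ₀ᴾ φ → Δ₀ᴾ (∀⊆[ y ] φ)
  ∃⊆  : ∀ {n} (y : Fin n) {φ : Formula (suc n)} → Δ₀ᴾ φ → Δ₀ᴾ (∃⊆[ y ] φ)

-- Any finite number of unbounded quantifiers, including none, may be prefixed.
data Σ₁ᴾ : Class where
  base : ∀ {n} {φ : Formula n} → Δ₀ᴾ φ → Σ₁ᴾ φ
  ex   : ∀ {n} {φ : Formula (suc n)} → Σ₁ᴾ φ → Σ₁ᴾ (∃′ φ)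

data Π₁ᴾ : Class where
  base : ∀ {n} {φ : Formula n} → Δ₀ᴾ φ → Π₁ᴾ φ
  all  : ∀ {n} {φ : Formula (suc n)} → Π₁ᴾ φ → Π₁ᴾ (∀′ φ)

-- φ(x,z⃗) has x as variable 0.  Under the quantifiers, the variables are
-- x = 0, y = 1, w = 2, followed by z⃗.
separation : ∀ {n} → Formula (suc n) → Sentence
separation {n} φ = closure n
  (∀′ ∃′ ∀′ (0F ∈ 1F ⇔ 0F ∈ 2F ∧ rename (lift 1 (λ i → suc (suc i))) φ))

-- φ(x,y,z⃗) has y as variable 0 and x as variable 1.  On the left the variables
-- are y = 0, x = 1, w = 2, z⃗; on the right y = 0, x = 1, C = 2, w = 3, z⃗.
collection : ∀ {n} → Formula (suc (suc n)) → Sentence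
collection {n} φ = closure n
  (∀′ ((∀∈[ 0F ] ∃′ rename (lift 2 suc) φ)
       ⇒ (∃′ ∀∈[ 1F ] ∃∈[ 1F ] rename (lift 2 (λ i → suc (suc i))) φ)))

-- φ(x,z⃗) has x as variable 0.  In the conclusion the bound variable y takes its
-- place; the inner occurrence has x = 0, y = 1, followed by z⃗.
foundation : ∀ {n} → Formula (suc n) → Sentence
foundation {n} φ = closure n
  ((∃′ φ) ⇒ (∃′ (φ ∧ (∀∈[ 0F ] ¬ rename (lift 1 suc) φ))))

data Separation (Γ : Class) : Theory where
  inst : ∀ {n} {φ : Formula (suc n)} → Γ φ → Separation Γ (separation φ)

data Collection (Γ : Class) : Theory where
  inst : ∀ {n} {φ : Formula (suc (suc n))} → Γ φ → Collection Γ (collection φ)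

data Foundation (Γ : Class) : Theory where
  inst : ∀ {n} {φ : Formula (suc n)} → Γ φ → Foundation Γ (foundation φ)

-- The class {x ∈ z}, with x = 0 and the parameter z = 1.
data Membership : Class where
  x∈z : Membership {2} (0F ∈ 1F)

extensionality emptyset pair union difference powerset TCo infinity : Sentence

extensionality = ∀′ ∀′ ((∀′ (0F ∈ 2F ⇔ 0F ∈ 1F)) ⇒ 1F ≐ 0F)

emptyset = ∃′ ∀′ 0F ∉ 1F

pair = ∀′ ∀′ ∃′ ∀′ (0F ∈ 1F ⇔ 0F ≐ 3F ∨ 0F ≐ 2F)

union = ∀′ ∃′ ∀′ (0F ∈ 1F ⇔ (∃∈[ 2F ] 1F ∈ 0F))

difference = ∀′ ∀′ ∃′ ∀′ (0F ∈ 1F ⇔ 0F ∈ 3F ∧ 0F ∉ 2F)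

powerset = ∀′ ∃′ ∀′ (0F ∈ 1F ⇔ 0F ⊆ 2F)

TCo = ∀′ ∃′ (1F ⊆ 0F ∧ (∀∈[ 0F ] 0F ⊆ 1F))

-- ∃x (∅ ∈ x ∧ (∀y∈x) y ∪ {y} ∈ x), with ∅ and y ∪ {y} given by their elements.
infinity = ∃′ ((∃∈[ 0F ] ∀′ 0F ∉ 1F)
               ∧ (∀∈[ 0F ] ∃∈[ 1F ] ∀′ (0F ∈ 1F ⇔ 0F ∈ 2F ∨ 0F ≐ 2F)))

finiteAxioms : List Sentence
finiteAxioms = extensionality ∷ emptyset ∷ pair ∷ union ∷ difference
             ∷ powerset ∷ TCo ∷ infinity ∷ []

M : Theory
M = (_∈ˡ finiteAxioms) ∪ Separation Δ₀ ∪ Foundation Membership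

KPᴾ : Theory
KPᴾ = M ∪ Collection Δ₀ᴾ ∪ Foundation Π₁ᴾ

{-# OPTIONS --safe #-}
module Submission where

open import Defs
open import Data.Empty using () renaming (⊥-elim to Empty-elim)
open import Data.Fin using (Fin; zero; suc; lift; _↑ʳ_)
open import Data.Fin.Patterns using (0F; 1F; 2F; 3F; 4F)
open import Data.List using (List; []; _∷_; _++_; map; drop; allFin; cartesianProductWith)
open import Data.List.Membership.Propositional using () renaming (_∈_ to _∈ˡ_)
open import Data.List.Membership.Propositional.Properties
  using (∈-map⁺; ∈-++⁺ˡ; ∈-++⁺ʳ; ∈-allFin; ∈-cartesianProductWith⁺)
open import Data.List.Properties using (map-∘; map-cong)
open import Data.List.Relation.Binary.Subset.Propositional using () renaming (_⊆_ to _⊆ˡ_)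
open import Data.List.Relation.Binary.Subset.Propositional.Properties
  using (∷⁺ʳ; map⁺; xs⊆xs++ys; xs⊆ys++xs)
open import Data.List.Relation.Unary.All as All using (All; []; _∷_)
import Data.List.Relation.Unary.All.Properties as All
open import Data.List.Relation.Unary.Any using (here; there)
open import Data.Nat
  using (ℕ; zero; suc; _+_; _⊔_; _≤_; z≤n; s≤s; _≤′_; _<′_; ≤′-refl; ≤′-step; <′-base)
open import Data.Nat.Properties
  using (≤⇒≤′; ≤′⇒≤; ≤′-trans; <-irrefl; n≮0; m≤m⊔n; m≤n⊔m; ≤-trans; ≤-reflexive;
         m⊔n≤o⇒m≤o; m⊔n≤o⇒n≤o)
open import Data.Product using (Σ-syntax; ∃-syntax; _×_; _,_; proj₁; proj₂)
open import Data.Sum using (_⊎_; inj₁; inj₂)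
open import Data.Vec using (Vec; []; _∷_; lookup)
open import Data.Vec.Functional using () renaming (_∷_ to _∷ᶠ_)
open import Function using (_∘_; id)
open import Level using (0ℓ)
open import Relation.Binary.PropositionalEquality
  using (_≡_; refl; sym; trans; cong; cong₂; subst; subst₂; _≗_)
open import Relation.Unary using (Pred)

-- By Henkin's theorem it is enough to argue in an arbitrary model. Suppose that
-- φ(x) = ∃y ψ(y,x) holds of x₀ and has no ∈-minimal instance, and let X be transitive
-- with x₀ ∈ X. Call C → C′ a step if every x ∈ X with a witness y ⊆ C has an element x′
-- with a witness y′ ⊆ C′; by Collection every C has a step C → C′. Without choice, and
-- without recursion, there is no canonical sequence of steps, but Π₁ᴾ-Foundation shows
-- that every x is the first component of a pair in some set h of pairs (u,W), W a level
-- V_α that contains a fixed witness for x₀, such that for all (u,W) ∈ h and z ∈ u there is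
-- (z,W′) ∈ h with a step W′ → W. Take such an h for a set x = I without
-- ∈-maximal element, and let C be the least level such that every x ∈ I has some
-- (x,W) ∈ h with W ∈ C. If x ∈ X has a witness y ∈ C, then y ⊆ V ∈ C for a level V, and V
-- fails to have the property at some u ∈ I. For u ∈ u⁺ ∈ I take (u⁺,W) ∈ h with W ∈ C and
-- then (u,W′) ∈ h with W′ → W; since W′ ∉ V, also y ⊆ V ⊆ W′, so some x′ ∈ x has a witness
-- y′ ⊆ W ∈ C, whence y′ ∈ C. So { x ∈ X : x has a witness in C } has no ∈-minimal element.

private variable
  k m n : ℕ
  T : Theory
  Γ Δ : List (Formula n)
  φ ψ χ : Formula n
  σ : Sentence

-- Renaming of formulae and derivations

lift-cong : {f g : Fin m → Fin n} → f ≗ g → lift 1 f ≗ lift 1 g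
lift-cong e zero    = refl
lift-cong e (suc i) = cong suc (e i)

rename-cong : {f g : Fin m → Fin n} → f ≗ g → rename f ≗ rename g
rename-cong e (x ∈ y) = cong₂ _∈_ (e x) (e y)
rename-cong e (x ≐ y) = cong₂ _≐_ (e x) (e y)
rename-cong e ⊥       = refl
rename-cong e (φ ∧ ψ) = cong₂ _∧_ (rename-cong e φ) (rename-cong e ψ)
rename-cong e (φ ∨ ψ) = cong₂ _∨_ (rename-cong e φ) (rename-cong e ψ)
rename-cong e (φ ⇒ ψ) = cong₂ _⇒_ (rename-cong e φ) (rename-cong e ψ)
rename-cong e (∀′ φ)  = cong ∀′_ (rename-cong (lift-cong e) φ)
rename-cong e (∃′ φ)  = cong ∃′_ (rename-cong (lift-cong e) φ)

lift-∘ : (g : Fin m → Fin n) (f : Fin k → Fin m) → lift 1 g ∘ lift 1 f ≗ lift 1 (g ∘ f)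
lift-∘ g f zero    = refl
lift-∘ g f (suc i) = refl

rename-∘ : (g : Fin m → Fin n) (f : Fin k → Fin m) →
           rename g ∘ rename f ≗ rename (g ∘ f)
rename-∘ g f (x ∈ y) = refl
rename-∘ g f (x ≐ y) = refl
rename-∘ g f ⊥       = refl
rename-∘ g f (φ ∧ ψ) = cong₂ _∧_ (rename-∘ g f φ) (rename-∘ g f ψ)
rename-∘ g f (φ ∨ ψ) = cong₂ _∨_ (rename-∘ g f φ) (rename-∘ g f ψ)
rename-∘ g f (φ ⇒ ψ) = cong₂ _⇒_ (rename-∘ g f φ) (rename-∘ g f ψ)
rename-∘ g f (∀′ φ)  = cong ∀′_ (trans (rename-∘ _ _ φ) (rename-cong (lift-∘ g f) φ))
rename-∘ g f (∃′ φ)  = cong ∃′_ (trans (rename-∘ _ _ φ) (rename-cong (lift-∘ g f) φ))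

lift-id : lift 1 id ≗ id {A = Fin (suc n)}
lift-id zero    = refl
lift-id (suc i) = refl

rename-id : rename id ≗ id {A = Formula n}
rename-id (x ∈ y) = refl
rename-id (x ≐ y) = refl
rename-id ⊥       = refl
rename-id (φ ∧ ψ) = cong₂ _∧_ (rename-id φ) (rename-id ψ)
rename-id (φ ∨ ψ) = cong₂ _∨_ (rename-id φ) (rename-id ψ)
rename-id (φ ⇒ ψ) = cong₂ _⇒_ (rename-id φ) (rename-id ψ)
rename-id (∀′ φ)  = cong ∀′_ (trans (rename-cong lift-id φ) (rename-id φ))
rename-id (∃′ φ)  = cong ∃′_ (trans (rename-cong lift-id φ) (rename-id φ))

rename-weaken : (f : Fin m → Fin n) →
                rename (lift 1 f) ∘ weaken ≗ weaken ∘ rename f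
rename-weaken f φ = trans (rename-∘ _ _ φ) (sym (rename-∘ _ _ φ))

rename-lift-[] : (f : Fin m → Fin n) (t : Fin n) (φ : Formula (suc m)) →
                 rename (lift 1 f) φ [ t ] ≡ rename (t ∷ᶠ f) φ
rename-lift-[] f t φ =
  trans (rename-∘ _ _ φ) (rename-cong (λ { zero → refl ; (suc i) → refl }) φ)

rename-[] : (f : Fin m → Fin n) (t : Fin m) (φ : Formula (suc m)) →
            rename f (φ [ t ]) ≡ rename (lift 1 f) φ [ f t ]
rename-[] f t φ =
  trans (rename-∘ _ _ φ)
  (trans (rename-cong (λ { zero → refl ; (suc i) → refl }) φ)
         (sym (rename-lift-[] f (f t) φ)))

lift-suc-[0] : (φ : Formula (suc n)) → rename (lift 1 suc) φ [ zero ] ≡ φ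
lift-suc-[0] φ = trans (rename-lift-[] suc zero φ)
  (trans (rename-cong (λ { zero → refl ; (suc i) → refl }) φ) (rename-id φ))

⊢-≡ : φ ≡ ψ → T ∣ Γ ⊢ φ → T ∣ Γ ⊢ ψ
⊢-≡ refl d = d

⊢-mono : Γ ⊆ˡ Δ → T ∣ Γ ⊢ φ → T ∣ Δ ⊢ φ
⊢-mono s (axiom a)     = axiom a
⊢-mono s (hyp h)       = hyp (s h)
⊢-mono s (raa d)       = raa (⊢-mono (∷⁺ʳ _ s) d)
⊢-mono s (∧I d e)      = ∧I (⊢-mono s d) (⊢-mono s e)
⊢-mono s (∧E₁ d)       = ∧E₁ (⊢-mono s d)
⊢-mono s (∧E₂ d)       = ∧E₂ (⊢-mono s d)
⊢-mono s (∨I₁ d)       = ∨I₁ (⊢-mono s d)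
⊢-mono s (∨I₂ d)       = ∨I₂ (⊢-mono s d)
⊢-mono s (∨E d e f)    = ∨E (⊢-mono s d) (⊢-mono (∷⁺ʳ _ s) e) (⊢-mono (∷⁺ʳ _ s) f)
⊢-mono s (⇒I d)        = ⇒I (⊢-mono (∷⁺ʳ _ s) d)
⊢-mono s (⇒E d e)      = ⇒E (⊢-mono s d) (⊢-mono s e)
⊢-mono s (∀I d)        = ∀I (⊢-mono (map⁺ weaken s) d)
⊢-mono s (∀E d t)      = ∀E (⊢-mono s d) t
⊢-mono s (∃I t d)      = ∃I t (⊢-mono s d)
⊢-mono s (∃E d e)      = ∃E (⊢-mono s d) (⊢-mono (∷⁺ʳ _ (map⁺ weaken s)) e)
⊢-mono s (≐refl t)     = ≐refl t
⊢-mono s (≐sub φ d e)  = ≐sub φ (⊢-mono s d) (⊢-mono s e)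
⊢-mono s inhab         = inhab

map-rename-weaken : (f : Fin m → Fin n) (Γ : List (Formula m)) →
                    map (rename (lift 1 f)) (map weaken Γ) ≡ map weaken (map (rename f) Γ)
map-rename-weaken f Γ =
  trans (sym (map-∘ Γ)) (trans (map-cong (rename-weaken f) Γ) (map-∘ Γ))

⊢-rename : (f : Fin m → Fin n) → T ∣ Γ ⊢ φ → T ∣ map (rename f) Γ ⊢ rename f φ
⊢-rename {T = T} {Γ = Γ} f = go
  where
  under : {Γ : List (Formula _)} {Δ : List (Formula _)} {φ : Formula _} →
          T ∣ Δ ++ map (rename (lift 1 f)) (map weaken Γ) ⊢ φ →
          T ∣ Δ ++ map weaken (map (rename f) Γ) ⊢ φ
  under {Γ} {Δ} = subst (λ Γ′ → T ∣ Δ ++ Γ′ ⊢ _) (map-rename-weaken f Γ)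
  go : {Γ : List (Formula _)} {φ : Formula _} → T ∣ Γ ⊢ φ → T ∣ map (rename f) Γ ⊢ rename f φ
  go (axiom {σ = σ} a) =
    ⊢-≡ (sym (trans (rename-∘ _ _ σ) (rename-cong (λ ()) σ))) (axiom a)
  go (hyp h)    = hyp (∈-map⁺ (rename f) h)
  go (raa d)    = raa (go d)
  go (∧I d e)   = ∧I (go d) (go e)
  go (∧E₁ d)    = ∧E₁ (go d)
  go (∧E₂ d)    = ∧E₂ (go d)
  go (∨I₁ d)    = ∨I₁ (go d)
  go (∨I₂ d)    = ∨I₂ (go d)
  go (∨E d e g) = ∨E (go d) (go e) (go g)
  go (⇒I d)     = ⇒I (go d)
  go (⇒E d e)   = ⇒E (go d) (go e)
  go (∀I d)     = ∀I (under {Δ = []} (⊢-rename (lift 1 f) d))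
  go (∀E {φ = φ} d t) = ⊢-≡ (sym (rename-[] f t φ)) (∀E (go d) (f t))
  go (∃I {φ = φ} t d) = ∃I (f t) (⊢-≡ (rename-[] f t φ) (go d))
  go (∃E {φ = φ} {χ} d e) =
    ∃E (go d) (under {Δ = rename (lift 1 f) φ ∷ []}
      (⊢-≡ (rename-weaken f χ) (⊢-rename (lift 1 f) e)))
  go (≐refl t)  = ≐refl (f t)
  go (≐sub {s = s} {t} φ d e) =
    ⊢-≡ (sym (rename-[] f t φ))
      (≐sub (rename (lift 1 f) φ) (go d) (⊢-≡ (rename-[] f s φ) (go e)))
  go inhab      = inhab

exFalso : T ∣ Γ ⊢ ⊥ → T ∣ Γ ⊢ φ
exFalso d = raa (⊢-mono there d)

-- The drinker principle: a Henkin axiom is provable under an existential quantifier, so it may be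
-- assumed of a fresh variable. `inhab` supplies an element in case `∃′ φ` fails.
drinker : (φ : Formula (suc n)) → T ∣ Γ ⊢ ∃′ (weaken (∃′ φ) ⇒ φ)
drinker φ = raa (∃E inhab (⇒E (hyp (there (here refl)))
  (∃I zero (⊢-≡ (sym (lift-suc-[0] (weaken (∃′ φ) ⇒ φ)))
    (⇒I (exFalso (∃E (hyp (here refl)) (⇒E (hyp (there (there (there (here refl)))))
      (∃I zero (⇒I (⊢-≡ (sym (lift-suc-[0] (rename (lift 1 suc) φ)))
        (hyp (there (here refl))))))))))))))

¬∀⇒∃¬ : T ∣ Γ ⊢ ¬ (∀′ φ) → T ∣ Γ ⊢ ∃′ (¬ φ)
¬∀⇒∃¬ {φ = φ} d = raa (⇒E (⊢-mono there d) (∀I (raa (⇒E (hyp (there (here refl)))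
  (∃I zero (⊢-≡ (sym (lift-suc-[0] (¬ φ))) (hyp (here refl))))))))

-- Completeness

-- Falsity is interpreted by an arbitrary set 𝔽, and a Model need not have 𝔽 empty: for such
-- models completeness is constructive. Accordingly ∨ is read negatively.
record Structure : Set₁ where
  infix 8 _ε_ _≈_
  field
    D : Set
    _ε_ _≈_ : D → D → Set
    𝔽 : Set

  ⟦_⟧ : Formula n → Vec D n → Set
  ⟦ x ∈ y ⟧ ρ = lookup ρ x ε lookup ρ y
  ⟦ x ≐ y ⟧ ρ = lookup ρ x ≈ lookup ρ y
  ⟦ ⊥ ⟧ ρ     = 𝔽
  ⟦ φ ∧ ψ ⟧ ρ = ⟦ φ ⟧ ρ × ⟦ ψ ⟧ ρ
  ⟦ φ ∨ ψ ⟧ ρ = (⟦ φ ⟧ ρ → 𝔽) → (⟦ ψ ⟧ ρ → 𝔽) → 𝔽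
  ⟦ φ ⇒ ψ ⟧ ρ = ⟦ φ ⟧ ρ → ⟦ ψ ⟧ ρ
  ⟦ ∀′ φ ⟧ ρ  = ∀ d → ⟦ φ ⟧ (d ∷ ρ)
  ⟦ ∃′ φ ⟧ ρ  = Σ[ d ∈ D ] ⟦ φ ⟧ (d ∷ ρ)

record Model : Set₁ where
  field structure : Structure
  open Structure structure public
  field
    stable : (φ : Formula n) (ρ : Vec D n) → ((⟦ φ ⟧ ρ → 𝔽) → 𝔽) → ⟦ φ ⟧ ρ
    ≈-refl : ∀ {d} → d ≈ d
    ≈-subst : ∀ (φ : Formula (suc n)) ρ {d e} → d ≈ e → ⟦ φ ⟧ (d ∷ ρ) → ⟦ φ ⟧ (e ∷ ρ)

infix 1 _⊨_
_⊨_ : Model → Sentence → Set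
𝓜 ⊨ σ = Model.⟦_⟧ 𝓜 σ []

-- Enumeration of formulae

depth : Formula n → ℕ
depth (x ∈ y) = 1
depth (x ≐ y) = 1
depth ⊥       = 1
depth (φ ∧ ψ) = suc (depth φ ⊔ depth ψ)
depth (φ ∨ ψ) = suc (depth φ ⊔ depth ψ)
depth (φ ⇒ ψ) = suc (depth φ ⊔ depth ψ)
depth (∀′ φ)  = suc (depth φ)
depth (∃′ φ)  = suc (depth φ)

depth-rename : (f : Fin m → Fin n) → depth ∘ rename f ≗ depth
depth-rename f (x ∈ y) = refl
depth-rename f (x ≐ y) = refl
depth-rename f ⊥       = refl
depth-rename f (φ ∧ ψ) = cong suc (cong₂ _⊔_ (depth-rename f φ) (depth-rename f ψ))
depth-rename f (φ ∨ ψ) = cong suc (cong₂ _⊔_ (depth-rename f φ) (depth-rename f ψ))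
depth-rename f (φ ⇒ ψ) = cong suc (cong₂ _⊔_ (depth-rename f φ) (depth-rename f ψ))
depth-rename f (∀′ φ)  = cong suc (depth-rename (lift 1 f) φ)
depth-rename f (∃′ φ)  = cong suc (depth-rename (lift 1 f) φ)

enumerate : ℕ → ∀ n → List (Formula n)
enumerate zero    n = []
enumerate (suc d) n =
  cartesianProductWith _∈_ (allFin n) (allFin n) ++
  cartesianProductWith _≐_ (allFin n) (allFin n) ++
  (⊥ ∷ []) ++
  cartesianProductWith _∧_ (enumerate d n) (enumerate d n) ++
  cartesianProductWith _∨_ (enumerate d n) (enumerate d n) ++
  cartesianProductWith _⇒_ (enumerate d n) (enumerate d n) ++
  map ∀′_ (enumerate d (suc n)) ++
  map ∃′_ (enumerate d (suc n))

depth>0 : (φ : Formula n) → 1 ≤ depth φ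
depth>0 (x ∈ y) = s≤s z≤n
depth>0 (x ≐ y) = s≤s z≤n
depth>0 ⊥       = s≤s z≤n
depth>0 (φ ∧ ψ) = s≤s z≤n
depth>0 (φ ∨ ψ) = s≤s z≤n
depth>0 (φ ⇒ ψ) = s≤s z≤n
depth>0 (∀′ φ)  = s≤s z≤n
depth>0 (∃′ φ)  = s≤s z≤n

enumerate-complete : ∀ d (φ : Formula n) → depth φ ≤ d → φ ∈ˡ enumerate d n
enumerate-complete zero φ δ = Empty-elim (n≮0 (≤-trans (depth>0 φ) δ))
enumerate-complete {n = n} (suc d) φ δ = go φ δ
  where
  xs = allFin n
  es = enumerate d n
  c₁ = cartesianProductWith {C = Formula n} _∈_ xs xs
  c₂ = cartesianProductWith {C = Formula n} _≐_ xs xs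
  c₄ = cartesianProductWith _∧_ es es
  c₅ = cartesianProductWith _∨_ es es
  c₆ = cartesianProductWith _⇒_ es es
  c₇ = map ∀′_ (enumerate d (suc n))
  binary : (_⊙_ : Formula n → Formula n → Formula n) (φ ψ : Formula n) →
           depth φ ⊔ depth ψ ≤ d → (φ ⊙ ψ) ∈ˡ cartesianProductWith _⊙_ es es
  binary _⊙_ φ ψ δ = ∈-cartesianProductWith⁺ _⊙_
    (enumerate-complete d φ (m⊔n≤o⇒m≤o (depth φ) (depth ψ) δ))
    (enumerate-complete d ψ (m⊔n≤o⇒n≤o (depth φ) (depth ψ) δ))
  go : (φ : Formula n) → depth φ ≤ suc d → φ ∈ˡ enumerate (suc d) n
  go (x ∈ y) δ = ∈-++⁺ˡ (∈-cartesianProductWith⁺ _∈_ (∈-allFin x) (∈-allFin y))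
  go (x ≐ y) δ = ∈-++⁺ʳ c₁ (∈-++⁺ˡ (∈-cartesianProductWith⁺ _≐_ (∈-allFin x) (∈-allFin y)))
  go ⊥ δ       = ∈-++⁺ʳ c₁ (∈-++⁺ʳ c₂ (here refl))
  go (φ ∧ ψ) (s≤s δ) = ∈-++⁺ʳ c₁ (∈-++⁺ʳ c₂ (there (∈-++⁺ˡ (binary _∧_ φ ψ δ))))
  go (φ ∨ ψ) (s≤s δ) = ∈-++⁺ʳ c₁ (∈-++⁺ʳ c₂ (there (∈-++⁺ʳ c₄ (∈-++⁺ˡ (binary _∨_ φ ψ δ)))))
  go (φ ⇒ ψ) (s≤s δ) = ∈-++⁺ʳ c₁ (∈-++⁺ʳ c₂ (there (∈-++⁺ʳ c₄ (∈-++⁺ʳ c₅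
    (∈-++⁺ˡ (binary _⇒_ φ ψ δ))))))
  go (∀′ φ) (s≤s δ) = ∈-++⁺ʳ c₁ (∈-++⁺ʳ c₂ (there (∈-++⁺ʳ c₄ (∈-++⁺ʳ c₅ (∈-++⁺ʳ c₆
    (∈-++⁺ˡ (∈-map⁺ ∀′_ (enumerate-complete d φ δ))))))))
  go (∃′ φ) (s≤s δ) = ∈-++⁺ʳ c₁ (∈-++⁺ʳ c₂ (there (∈-++⁺ʳ c₄ (∈-++⁺ʳ c₅ (∈-++⁺ʳ c₆
    (∈-++⁺ʳ c₇ (∈-map⁺ ∃′_ (enumerate-complete d φ δ))))))))

-- First in, first out: each stage drops the head, appends the finitely many formulae of depth at
-- most `k` in the variables at hand, and weakens everything into the scope of its new variable. So
-- every formula comes to the front eventually.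
queue : ∀ k → List (Formula k)
queue zero    = []
queue (suc k) = map weaken (drop 1 (queue k) ++ enumerate k k)

target : ∀ k → Formula k
target k with queue k
-- A harmless default: `⊥` passes the proviso of `stage` only in the presence of `Absurd`, and its
-- Henkin axiom is trivial.
... | []    = ⊥
... | φ ∷ _ = φ

-- Variable 0 of the longer scope acts as the new constant witnessing an existential target; other
-- targets receive a tautology.
henkin : Formula k → Formula (suc k)
henkin (∃′ φ) = weaken (∃′ φ) ⇒ φ
henkin _      = ⊥ ⇒ ⊥

∃henkin : (φ : Formula k) → T ∣ Γ ⊢ ∃′ henkin φ
∃henkin (∃′ φ) = drinker φ
∃henkin (x ∈ y) = ∃E inhab (∃I zero (⇒I (hyp (here refl))))
∃henkin (x ≐ y) = ∃E inhab (∃I zero (⇒I (hyp (here refl))))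
∃henkin ⊥ = ∃E inhab (∃I zero (⇒I (hyp (here refl))))
∃henkin (φ ∧ ψ) = ∃E inhab (∃I zero (⇒I (hyp (here refl))))
∃henkin (φ ∨ ψ) = ∃E inhab (∃I zero (⇒I (hyp (here refl))))
∃henkin (φ ⇒ ψ) = ∃E inhab (∃I zero (⇒I (hyp (here refl))))
∃henkin (∀′ φ) = ∃E inhab (∃I zero (⇒I (hyp (here refl))))

-- The variable with index at p at stage K is the one introduced by stage d.
at : ∀ {d K} → d <′ K → Fin K
at <′-base     = zero
at (≤′-step p) = suc (at p)

at-cong : ∀ {d e K} (p : d <′ K) (q : e <′ K) → d ≡ e → at p ≡ at q
at-cong <′-base     <′-base     e   = refl
at-cong <′-base     (≤′-step q) refl = Empty-elim (<-irrefl refl (≤′⇒≤ q))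
at-cong (≤′-step p) <′-base     refl = Empty-elim (<-irrefl refl (≤′⇒≤ p))
at-cong (≤′-step p) (≤′-step q) e   = cong suc (at-cong p q e)

Below : Vec ℕ n → ℕ → Set
Below ρ K = ∀ i → lookup ρ i <′ K

below : (ρ : Vec ℕ n) → ∃[ K ] Below ρ K
below []      = 0 , λ ()
below (d ∷ ρ) with below ρ
... | K , p = suc d ⊔ K , λ where
  zero    → ≤⇒≤′ (m≤m⊔n (suc d) K)
  (suc i) → ≤′-trans (p i) (≤⇒≤′ (m≤n⊔m (suc d) K))

raise : ∀ {K L} (ρ : Vec ℕ n) → Below ρ K → K ≤′ L → Below ρ L
raise ρ p l i = ≤′-trans (p i) l

realise : ∀ {K} (ρ : Vec ℕ n) → Below ρ K → Formula n → Formula K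
realise ρ p = rename (at ∘ p)

data At {A : Set} : ℕ → A → List A → Set where
  here  : ∀ {x xs} → At zero x (x ∷ xs)
  there : ∀ {i x y xs} → At i x xs → At (suc i) x (y ∷ xs)

∈⇒At : {A : Set} {x : A} {xs : List A} → x ∈ˡ xs → ∃[ i ] At i x xs
∈⇒At (here refl) = 0 , here
∈⇒At (there h)   = let i , a = ∈⇒At h in suc i , there a

At-++ : ∀ {A : Set} {i} {x : A} {xs ys} → At i x xs → At i x (xs ++ ys)
At-++ here      = here
At-++ (there a) = there (At-++ a)

At-map : ∀ {A B : Set} (f : A → B) {i x xs} → At i x xs → At i (f x) (map f xs)
At-map f here      = here
At-map f (there a) = there (At-map f a)

-- Induction on the position in the queue: position 0 is the target, and any other position drops by
-- one at the next stage.
queued⇒targeted : ∀ {K i} (ρ : Vec ℕ n) (p : Below ρ K) φ → At i (realise ρ p φ) (queue K) →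
                  ∃[ k ] Σ[ q ∈ Below ρ k ] target k ≡ realise ρ q φ
queued⇒targeted {K = K} {zero} ρ p φ a = K , p , front a
  where
  front : ∀ {χ} → At 0 χ (queue K) → target K ≡ χ
  front a with queue K
  front here | _ = refl
queued⇒targeted {K = K} {suc i} ρ p φ a =
  queued⇒targeted {K = suc K} {i} ρ (λ j → ≤′-step (p j)) φ
    (subst (λ χ → At i χ (queue (suc K))) (rename-∘ suc (at ∘ p) φ) (At-map weaken (At-++ (pop a))))
  where
  pop : ∀ {χ} {χs : List (Formula K)} → At (suc i) χ χs → At i χ (drop 1 χs)
  pop (there a) = a

targeted : (ρ : Vec ℕ n) (φ : Formula n) →
           ∃[ k ] Σ[ p ∈ Below ρ k ] target k ≡ realise ρ p φ
targeted ρ φ = queued⇒targeted {K = suc K} ρ (λ j → ≤′-step (p j)) φ (proj₂ (∈⇒At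
  (subst (_∈ˡ queue (suc K)) (rename-∘ suc (at ∘ p) φ) (∈-map⁺ weaken (∈-++⁺ʳ _
    (enumerate-complete K (realise ρ p φ)
      (≤-trans (≤-reflexive (depth-rename _ φ)) (m≤n⊔m K₀ (depth φ)))))))))
  where
  K₀ = proj₁ (below ρ)
  -- Late enough for the entries of `ρ` to exist as variables and for the enumeration to reach the
  -- depth of `φ`.
  K  = K₀ ⊔ depth φ
  p  = raise ρ (proj₂ (below ρ)) (≤⇒≤′ (m≤m⊔n K₀ (depth φ)))

-- The Henkin stages

infix 1 _∣_⊩_

_∣_⊩_ : Theory → Pred (Formula n) 0ℓ → Formula n → Set
T ∣ P ⊩ φ = Σ[ Γ ∈ List _ ] All P Γ × (T ∣ Γ ⊢ φ)

module Henkin (T : Theory) (σ : Sentence) where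

  -- This becomes falsity in the term model: a contradiction found there is then itself a derivation
  -- of `⊥` from `¬ σ`.
  Absurd : Set
  Absurd = T ∣ (¬ σ) ∷ [] ⊢ ⊥

  -- The target enters stage suc k whenever it is consistent with stage k. Consistency
  -- is undecidable, hence the proviso inside the stage; it is relative to Absurd, so
  -- that no stage proves ⊥ unless T together with ¬ σ does.
  stage : ∀ k → Pred (Formula k) 0ℓ
  stage zero    φ = φ ≡ ¬ σ
  stage (suc k) φ =
    (∃[ ψ ] stage k ψ × φ ≡ weaken ψ) ⊎
    (((Γ : List (Formula k)) → All (stage k) Γ → T ∣ target k ∷ Γ ⊢ ⊥ → Absurd)
      × φ ≡ weaken (target k)) ⊎
    φ ≡ henkin (target k)

  ⊢ₖ_ : Formula k → Set
  ⊢ₖ φ = T ∣ stage _ ⊩ φ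

  ⊢ₖ-lift₂ : (∀ {Γ} → T ∣ Γ ⊢ φ → T ∣ Γ ⊢ ψ → T ∣ Γ ⊢ χ) → ⊢ₖ φ → ⊢ₖ ψ → ⊢ₖ χ
  ⊢ₖ-lift₂ f (Γ , a , d) (Δ , b , e) =
    Γ ++ Δ , All.++⁺ a b , f (⊢-mono (xs⊆xs++ys Γ Δ) d) (⊢-mono (xs⊆ys++xs Δ Γ) e)

  ⊢ₖ-lift : (∀ {Γ} → T ∣ Γ ⊢ φ → T ∣ Γ ⊢ ψ) → ⊢ₖ φ → ⊢ₖ ψ
  ⊢ₖ-lift f (Γ , a , d) = Γ , a , f d

  ⊢ₖ-hyp : stage k φ → ⊢ₖ φ
  ⊢ₖ-hyp {φ = φ} s = φ ∷ [] , s ∷ [] , hyp (here refl)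

  ⊢ₖ-weaken : {φ : Formula k} → ⊢ₖ φ → ⊢ₖ weaken φ
  ⊢ₖ-weaken (Γ , a , d) =
    map weaken Γ , All.map⁺ (All.map (λ s → inj₁ (_ , s , refl)) a) , ⊢-rename suc d

  Split : List (Formula (suc k)) → Set
  Split {k} Δ = Σ[ Γ ∈ List (Formula k) ] All (stage k) Γ ×
    (Δ ⊆ˡ henkin (target k) ∷ map weaken Γ ⊎
     ((Γ : List (Formula k)) → All (stage k) Γ → T ∣ target k ∷ Γ ⊢ ⊥ → Absurd)
       × Δ ⊆ˡ henkin (target k) ∷ map weaken (target k ∷ Γ))

  split : {Δ : List (Formula (suc k))} → All (stage (suc k)) Δ → Split Δ
  split [] = [] , [] , inj₁ (λ ())
  split (s ∷ ss) with split ss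
  split (inj₁ (ψ , s , refl) ∷ _) | Γ , a , inj₁ i =
    ψ ∷ Γ , s ∷ a , inj₁ (λ where
      (here refl) → there (here refl)
      (there h)   → ∷⁺ʳ _ there (i h))
  split (inj₁ (ψ , s , refl) ∷ _) | Γ , a , inj₂ (c , i) =
    ψ ∷ Γ , s ∷ a , inj₂ (c , λ where
      (here refl) → there (there (here refl))
      (there h)   → ∷⁺ʳ _ (∷⁺ʳ _ there) (i h))
  split (inj₂ (inj₁ (c , refl)) ∷ _) | Γ , a , inj₁ i =
    Γ , a , inj₂ (c , λ where
      (here refl) → there (here refl)
      (there h)   → ∷⁺ʳ _ there (i h))
  split (inj₂ (inj₁ (c , refl)) ∷ _) | Γ , a , inj₂ (_ , i) =
    Γ , a , inj₂ (c , λ where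
      (here refl) → there (here refl)
      (there h)   → i h)
  split (inj₂ (inj₂ refl) ∷ _) | Γ , a , inj₁ i =
    Γ , a , inj₁ (λ where
      (here refl) → here refl
      (there h)   → i h)
  split (inj₂ (inj₂ refl) ∷ _) | Γ , a , inj₂ (c , i) =
    Γ , a , inj₂ (c , λ where
      (here refl) → here refl
      (there h)   → i h)

  -- The fresh variable occurs only in the Henkin axiom, which `∃henkin` therefore eliminates. What
  -- remains is a contradiction from stage `k` alone, left to induction, or from stage `k` with the
  -- target, left to the proviso.
  consistent : ∀ k → T ∣ stage k ⊩ ⊥ → Absurd
  consistent zero (Γ , a , d) = ⊢-mono (λ h → here (All.lookup a h)) d
  consistent (suc k) (Δ , a , d) with split a
  ... | Γ , b , inj₁ i       = consistent k (Γ , b , ∃E (∃henkin (target k)) (⊢-mono i d))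
  ... | Γ , b , inj₂ (c , i) = c Γ b (∃E (∃henkin (target k)) (⊢-mono i d))

  -- A number `d` in `ρ` names the variable introduced by stage `d`. Derivability persists to later
  -- stages by weakening, so the choice of `bound` is immaterial.
  record Holds (φ : Formula n) (ρ : Vec ℕ n) : Set where
    constructor holds
    field
      {bound} : ℕ
      bounded : Below ρ bound
      derivation : ⊢ₖ realise ρ bounded φ

  realise-cong : ∀ {K} (ρ : Vec ℕ n) (p q : Below ρ K) (φ : Formula n) →
                 realise ρ p φ ≡ realise ρ q φ
  realise-cong ρ p q = rename-cong (λ i → at-cong (p i) (q i) refl)

  ⊢ₖ-raise : ∀ {K L} (ρ : Vec ℕ n) (φ : Formula n) (p : Below ρ K) (q : Below ρ L) →
             K ≤′ L → ⊢ₖ realise ρ p φ → ⊢ₖ realise ρ q φ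
  ⊢ₖ-raise ρ φ p q ≤′-refl d = subst ⊢ₖ_ (realise-cong ρ p q φ) d
  ⊢ₖ-raise ρ φ p q (≤′-step l) d =
    subst ⊢ₖ_ (trans (rename-∘ suc _ φ) (realise-cong ρ (λ i → ≤′-step (raise ρ p l i)) q φ))
      (⊢ₖ-weaken (⊢ₖ-raise ρ φ p (raise ρ p l) l d))

  Holds-above : (K : ℕ) {φ : Formula n} {ρ : Vec ℕ n} → Holds φ ρ →
                ∃[ L ] K ≤′ L × Σ[ p ∈ Below ρ L ] ⊢ₖ realise ρ p φ
  Holds-above K {φ} {ρ} (holds {K′} p d) =
    K ⊔ K′ , ≤⇒≤′ (m≤m⊔n K K′) , q , ⊢ₖ-raise ρ φ p q l d
    where
    l = ≤⇒≤′ (m≤n⊔m K K′)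
    q = raise ρ p l

  Holds-lift : {φ ψ : Formula n} {ρ : Vec ℕ n} →
               (∀ {K} (p : Below ρ K) → ⊢ₖ realise ρ p φ → ⊢ₖ realise ρ p ψ) →
               Holds φ ρ → Holds ψ ρ
  Holds-lift f (holds p d) = holds p (f p d)

  Holds-lift₂ : {φ ψ χ : Formula n} {ρ : Vec ℕ n} →
                (∀ {K} (p : Below ρ K) → ⊢ₖ realise ρ p φ → ⊢ₖ realise ρ p ψ → ⊢ₖ realise ρ p χ) →
                Holds φ ρ → Holds ψ ρ → Holds χ ρ
  Holds-lift₂ {φ = φ} {ρ = ρ} f (holds {K} p d) h with Holds-above K h
  ... | L , l , q , e = holds q (f q (⊢ₖ-raise ρ φ p q l d) e)

  Holds-⊥ : {ρ : Vec ℕ n} → Holds ⊥ ρ → Absurd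
  Holds-⊥ (holds p d) = consistent _ d

  Holds-theorem : {φ : Formula n} {ρ : Vec ℕ n} →
                  (∀ {K} (p : Below ρ K) → T ∣ [] ⊢ realise ρ p φ) → Holds φ ρ
  Holds-theorem {ρ = ρ} f = let K , p = below ρ in holds p ([] , [] , f p)

  Holds-rename : (f : Fin m → Fin n) {φ : Formula m} {ρ : Vec ℕ m} {ρ′ : Vec ℕ n} →
                 (∀ i → lookup ρ′ (f i) ≡ lookup ρ i) → Holds φ ρ → Holds (rename f φ) ρ′
  Holds-rename f {φ} {ρ} {ρ′} e h with below ρ′
  ... | K , p with Holds-above K h
  ... | L , l , q , d = holds (raise ρ′ p l) (subst ⊢ₖ_
    (sym (trans (rename-∘ _ f φ)
      (rename-cong (λ i → at-cong (raise ρ′ p l (f i)) (q i) (e i)) φ))) d)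

  Holds-rename⁻ : (f : Fin m → Fin n) {φ : Formula m} {ρ : Vec ℕ m} {ρ′ : Vec ℕ n} →
                  (∀ i → lookup ρ′ (f i) ≡ lookup ρ i) → Holds (rename f φ) ρ′ → Holds φ ρ
  Holds-rename⁻ f {φ} {ρ} {ρ′} e h with below ρ
  ... | K , p with Holds-above K h
  ... | L , l , q , d = holds (raise ρ p l) (subst ⊢ₖ_
    (trans (rename-∘ _ f φ) (rename-cong (λ i → at-cong (q (f i)) (raise ρ p l i) (e i)) φ)) d)

  Holds-⇒E : {φ ψ : Formula n} {ρ : Vec ℕ n} → Holds (φ ⇒ ψ) ρ → Holds φ ρ → Holds ψ ρ
  Holds-⇒E = Holds-lift₂ (λ _ → ⊢ₖ-lift₂ ⇒E)

  -- Maximality of the union of the stages. `φ` is the target of some stage `k`; a refutation of it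
  -- there would make `¬ φ` hold and give `Absurd`, so the proviso is met and `φ` enters stage
  -- `suc k`.
  Holds-raa : (φ : Formula n) {ρ : Vec ℕ n} → (Holds (¬ φ) ρ → Absurd) → Holds φ ρ
  Holds-raa φ {ρ} no with targeted ρ φ
  ... | k , p , e = holds (λ i → ≤′-step (p i))
      (subst ⊢ₖ_ (trans (cong weaken e) (rename-∘ suc _ φ)) (⊢ₖ-hyp (inj₂ (inj₁ (maximal , refl)))))
    where
    maximal : (Γ : List (Formula k)) → All (stage k) Γ → T ∣ target k ∷ Γ ⊢ ⊥ → Absurd
    maximal Γ a d = no (holds p (Γ , a , ⇒I (subst (λ χ → T ∣ χ ∷ Γ ⊢ ⊥) e d)))

  Holds-stable : (φ : Formula n) {ρ : Vec ℕ n} → ((Holds φ ρ → Absurd) → Absurd) → Holds φ ρ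
  Holds-stable φ nn = Holds-raa φ (λ h¬φ → nn (λ hφ → Holds-⊥ (Holds-⇒E h¬φ hφ)))

  Holds-⇒I : (φ ψ : Formula n) {ρ : Vec ℕ n} → (Holds φ ρ → Holds ψ ρ) → Holds (φ ⇒ ψ) ρ
  Holds-⇒I φ ψ f = Holds-raa (φ ⇒ ψ) λ no → Holds-⊥ (Holds-⇒E no
    (Holds-lift (λ _ → ⊢ₖ-lift (λ d → ⇒I (⊢-mono there d)))
      (f (Holds-lift (λ _ → ⊢ₖ-lift (λ d → raa (⇒E (⊢-mono there d)
        (⇒I (exFalso (⇒E (hyp (there (here refl))) (hyp (here refl)))))))) no))))

  -- The witness is the number of a stage with target `∃′ φ`, since the Henkin axiom added there
  -- speaks of the new variable of that stage.
  Holds-∃E : {φ : Formula (suc n)} {ρ : Vec ℕ n} → Holds (∃′ φ) ρ → ∃[ d ] Holds φ (d ∷ ρ)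
  Holds-∃E {φ = φ} {ρ} h with targeted ρ (∃′ φ)
  ... | k , p , e = k , Holds-⇒E {φ = weaken (∃′ φ)}
      (holds q (⊢ₖ-hyp (inj₂ (inj₂ eq′)))) (Holds-rename suc (λ _ → refl) h)
    where
    q : Below (k ∷ ρ) (suc k)
    q zero    = <′-base
    q (suc i) = ≤′-step (p i)
    eq′ : realise (k ∷ ρ) q (weaken (∃′ φ) ⇒ φ) ≡ henkin (target k)
    eq′ = trans (cong₂ _⇒_
        (trans (rename-∘ _ suc (∃′ φ)) (sym (rename-∘ suc _ (∃′ φ))))
        (rename-cong (λ { zero → refl ; (suc i) → refl }) φ))
      (cong henkin (sym e))

  Holds-∃I : {φ : Formula (suc n)} {ρ : Vec ℕ n} {d : ℕ} → Holds φ (d ∷ ρ) → Holds (∃′ φ) ρ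
  Holds-∃I {φ = φ} (holds p d) = holds (p ∘ suc) (⊢ₖ-lift (λ d′ → ∃I (at (p zero))
    (⊢-≡ (trans (rename-cong (λ { zero → refl ; (suc i) → refl }) φ)
                (sym (rename-lift-[] _ _ φ))) d′)) d)

  Holds-∀E : {φ : Formula (suc n)} {ρ : Vec ℕ n} → Holds (∀′ φ) ρ → ∀ d → Holds φ (d ∷ ρ)
  Holds-∀E {φ = φ} h d = Holds-lift {φ = weaken (∀′ φ)} (λ p → ⊢ₖ-lift (λ d′ →
    ⊢-≡ (trans (rename-lift-[] _ (at (p zero)) _)
          (trans (rename-∘ _ _ φ) (rename-cong (λ { zero → refl ; (suc i) → refl }) φ)))
      (∀E d′ (at (p zero))))) (Holds-rename suc (λ _ → refl) h)

  Holds-∀I : (φ : Formula (suc n)) {ρ : Vec ℕ n} → (∀ d → Holds φ (d ∷ ρ)) → Holds (∀′ φ) ρ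
  Holds-∀I φ f = Holds-raa (∀′ φ) λ no →
    let d , h = Holds-∃E (Holds-lift {ψ = ∃′ (¬ φ)} (λ _ → ⊢ₖ-lift ¬∀⇒∃¬) no)
    in Holds-⊥ (Holds-⇒E h (f d))

  -- The term model

  termModel : Structure
  termModel = record
    { D   = ℕ
    ; _ε_ = λ d e → Holds (0F ∈ 1F) (d ∷ e ∷ [])
    ; _≈_ = λ d e → Holds (0F ≐ 1F) (d ∷ e ∷ [])
    ; 𝔽   = Absurd
    }
  open Structure termModel using (⟦_⟧)

  mutual
    -- The truth lemma. Its two directions are proved together because the antecedent of an
    -- implication exchanges them.
    holds⇒true : (φ : Formula n) (ρ : Vec ℕ n) → Holds φ ρ → ⟦ φ ⟧ ρ
    holds⇒true (x ∈ y) ρ h = Holds-rename⁻ (x ∷ᶠ λ _ → y) (λ { 0F → refl ; 1F → refl }) h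
    holds⇒true (x ≐ y) ρ h = Holds-rename⁻ (x ∷ᶠ λ _ → y) (λ { 0F → refl ; 1F → refl }) h
    holds⇒true ⊥ ρ h       = Holds-⊥ h
    holds⇒true (φ ∧ ψ) ρ h = holds⇒true φ ρ (Holds-lift (λ _ → ⊢ₖ-lift ∧E₁) h) ,
                             holds⇒true ψ ρ (Holds-lift (λ _ → ⊢ₖ-lift ∧E₂) h)
    holds⇒true (φ ∨ ψ) ρ h noφ noψ = Holds-⊥ (Holds-⇒E
      (Holds-⇒E (Holds-lift {ψ = ¬ φ ⇒ ¬ ψ ⇒ ⊥} (λ _ → ⊢ₖ-lift (λ d →
          ⇒I (⇒I (∨E (⊢-mono (λ h → there (there h)) d)
            (⇒E (hyp (there (there (here refl)))) (hyp (here refl)))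
            (⇒E (hyp (there (here refl))) (hyp (here refl))))))) h)
        (Holds-⇒I φ ⊥ (λ hφ → Holds-raa ⊥ (λ _ → noφ (holds⇒true φ ρ hφ)))))
      (Holds-⇒I ψ ⊥ (λ hψ → Holds-raa ⊥ (λ _ → noψ (holds⇒true ψ ρ hψ)))))
    holds⇒true (φ ⇒ ψ) ρ h t = holds⇒true ψ ρ (Holds-⇒E h (true⇒holds φ ρ t))
    holds⇒true (∀′ φ) ρ h d  = holds⇒true φ (d ∷ ρ) (Holds-∀E h d)
    holds⇒true (∃′ φ) ρ h    = let d , h′ = Holds-∃E h in d , holds⇒true φ (d ∷ ρ) h′

    true⇒holds : (φ : Formula n) (ρ : Vec ℕ n) → ⟦ φ ⟧ ρ → Holds φ ρ
    true⇒holds (x ∈ y) ρ h = Holds-rename (x ∷ᶠ λ _ → y) (λ { 0F → refl ; 1F → refl }) h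
    true⇒holds (x ≐ y) ρ h = Holds-rename (x ∷ᶠ λ _ → y) (λ { 0F → refl ; 1F → refl }) h
    true⇒holds ⊥ ρ t       = Holds-raa ⊥ (λ _ → t)
    true⇒holds (φ ∧ ψ) ρ (s , t) =
      Holds-lift₂ (λ _ → ⊢ₖ-lift₂ ∧I) (true⇒holds φ ρ s) (true⇒holds ψ ρ t)
    true⇒holds (φ ∨ ψ) ρ t = Holds-raa (φ ∨ ψ) λ no → t
      (λ tφ → Holds-⊥ (Holds-⇒E no (Holds-lift (λ _ → ⊢ₖ-lift ∨I₁) (true⇒holds φ ρ tφ))))
      (λ tψ → Holds-⊥ (Holds-⇒E no (Holds-lift (λ _ → ⊢ₖ-lift ∨I₂) (true⇒holds ψ ρ tψ))))
    true⇒holds (φ ⇒ ψ) ρ t = Holds-⇒I φ ψ (λ h → true⇒holds ψ ρ (t (holds⇒true φ ρ h)))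
    true⇒holds (∀′ φ) ρ t  = Holds-∀I φ (λ d → true⇒holds φ (d ∷ ρ) (t d))
    true⇒holds (∃′ φ) ρ (d , t) = Holds-∃I (true⇒holds φ (d ∷ ρ) t)

  ≐-subst : (φ : Formula (suc n)) (ρ : Vec ℕ n) {d e : ℕ} →
            Holds (0F ≐ 1F) (d ∷ e ∷ []) → Holds φ (d ∷ ρ) → Holds φ (e ∷ ρ)
  ≐-subst {n} φ ρ {d} {e} h hφ =
    Holds-rename⁻ (1F ∷ᶠ λ i → suc (suc i)) {ρ′ = d ∷ e ∷ ρ} (λ { zero → refl ; (suc i) → refl })
      (Holds-lift₂ {φ = 0F ≐ 1F} (λ p → ⊢ₖ-lift₂ λ d₁ d₂ →
        ⊢-≡ (instance-at p 1F) (≐sub (rename (lift 1 (λ i → at (p (suc (suc i))))) φ) d₁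
          (⊢-≡ (sym (instance-at p 0F)) d₂)))
        (Holds-rename (0F ∷ᶠ λ _ → 1F) (λ { 0F → refl ; 1F → refl }) h)
        (Holds-rename (0F ∷ᶠ λ i → suc (suc i)) (λ { zero → refl ; (suc i) → refl }) hφ))
    where
    instance-at : ∀ {K} (p : Below (d ∷ e ∷ ρ) K) (i : Fin (suc (suc n))) →
                  rename (lift 1 (λ j → at (p (suc (suc j))))) φ [ at (p i) ] ≡
                  realise (d ∷ e ∷ ρ) p (rename (i ∷ᶠ λ j → suc (suc j)) φ)
    instance-at p i = trans (rename-lift-[] _ _ φ)
      (trans (rename-cong (λ { zero → refl ; (suc j) → refl }) φ) (sym (rename-∘ _ _ φ)))

  model : Model
  model = record
    { structure = termModel
    ; stable  = λ φ ρ nn → holds⇒true φ ρ (Holds-stable φ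
                  (λ no → nn (λ t → no (true⇒holds φ ρ t))))
    ; ≈-refl  = Holds-theorem (λ p →
                  ⊢-≡ (cong (at (p 0F) ≐_) (at-cong (p 0F) (p 1F) refl)) (≐refl _))
    ; ≈-subst = λ φ ρ d≈e t → holds⇒true φ _ (≐-subst φ ρ d≈e (true⇒holds φ _ t))
    }

-- In the term model `σ` is true by assumption, while `¬ σ` holds because it forms stage zero.
-- Together they give `Absurd`, which `raa` turns into a proof of `σ`.
completeness : (∀ 𝓜 → (∀ {τ} → T τ → 𝓜 ⊨ τ) → 𝓜 ⊨ σ) → T ⊢ σ
completeness {T} {σ} valid = raa (Holds-⊥ (Holds-⇒E
  (holds (λ ()) (subst ⊢ₖ_ (sym (trans (rename-cong (λ ()) (¬ σ)) (rename-id (¬ σ))))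
    (⊢ₖ-hyp refl)))
  (true⇒holds σ [] (valid model λ {τ} a → holds⇒true τ [] (Holds-theorem (λ p →
    ⊢-≡ (rename-cong (λ ()) τ) (axiom a)))))))
  where open Henkin T σ

-- Consequences of KPᴾ in a model

Δ₀ᴾ-rename : (f : Fin m → Fin n) → Δ₀ᴾ φ → Δ₀ᴾ (rename f φ)
Δ₀ᴾ-rename f (mem x y) = mem (f x) (f y)
Δ₀ᴾ-rename f (eq x y)  = eq (f x) (f y)
Δ₀ᴾ-rename f bot       = bot
Δ₀ᴾ-rename f (and δ ε) = and (Δ₀ᴾ-rename f δ) (Δ₀ᴾ-rename f ε)
Δ₀ᴾ-rename f (or δ ε)  = or (Δ₀ᴾ-rename f δ) (Δ₀ᴾ-rename f ε)
Δ₀ᴾ-rename f (imp δ ε) = imp (Δ₀ᴾ-rename f δ) (Δ₀ᴾ-rename f ε)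
Δ₀ᴾ-rename f (∀∈ y δ)  = ∀∈ (f y) (Δ₀ᴾ-rename (lift 1 f) δ)
Δ₀ᴾ-rename f (∃∈ y δ)  = ∃∈ (f y) (Δ₀ᴾ-rename (lift 1 f) δ)
Δ₀ᴾ-rename f (∀⊆ y δ)  = ∀⊆ (f y) (Δ₀ᴾ-rename (lift 1 f) δ)
Δ₀ᴾ-rename f (∃⊆ y δ)  = ∃⊆ (f y) (Δ₀ᴾ-rename (lift 1 f) δ)

⊆-Δ₀ᴾ : (x y : Fin n) → Δ₀ᴾ (x ⊆ y)
⊆-Δ₀ᴾ x y = ∀∈ x (mem 0F (suc y))

-- Subset quantifiers are confined to members of `v`, which makes the formula `Δ₀`. Its meaning is
-- kept if `v` contains every subset that matters, and Separation for `Δ₀ᴾ` thereby reduces to `Δ₀`.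
relativise : {φ : Formula n} → (Fin n → Fin m) → Fin m → Δ₀ᴾ φ → Formula m
relativise f v (mem x y) = f x ∈ f y
relativise f v (eq x y)  = f x ≐ f y
relativise f v bot       = ⊥
relativise f v (and δ ε) = relativise f v δ ∧ relativise f v ε
relativise f v (or δ ε)  = relativise f v δ ∨ relativise f v ε
relativise f v (imp δ ε) = relativise f v δ ⇒ relativise f v ε
relativise f v (∀∈ y δ)  = ∀∈[ f y ] relativise (lift 1 f) (suc v) δ
relativise f v (∃∈ y δ)  = ∃∈[ f y ] relativise (lift 1 f) (suc v) δ
relativise f v (∀⊆ y δ)  = ∀∈[ v ] (0F ⊆ suc (f y) ⇒ relativise (lift 1 f) (suc v) δ)
relativise f v (∃⊆ y δ)  = ∃∈[ v ] (0F ⊆ suc (f y) ∧ relativise (lift 1 f) (suc v) δ)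

relativise-Δ₀ : {φ : Formula n} (f : Fin n → Fin m) (v : Fin m) (δ : Δ₀ᴾ φ) → Δ₀ (relativise f v δ)
relativise-Δ₀ f v (mem x y) = mem (f x) (f y)
relativise-Δ₀ f v (eq x y)  = eq (f x) (f y)
relativise-Δ₀ f v bot       = bot
relativise-Δ₀ f v (and δ ε) = and (relativise-Δ₀ f v δ) (relativise-Δ₀ f v ε)
relativise-Δ₀ f v (or δ ε)  = or (relativise-Δ₀ f v δ) (relativise-Δ₀ f v ε)
relativise-Δ₀ f v (imp δ ε) = imp (relativise-Δ₀ f v δ) (relativise-Δ₀ f v ε)
relativise-Δ₀ f v (∀∈ y δ)  = ∀∈ (f y) (relativise-Δ₀ (lift 1 f) (suc v) δ)
relativise-Δ₀ f v (∃∈ y δ)  = ∃∈ (f y) (relativise-Δ₀ (lift 1 f) (suc v) δ)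
relativise-Δ₀ f v (∀⊆ y δ)  =
  ∀∈ v (imp (∀∈ 0F (mem 0F (suc (suc (f y))))) (relativise-Δ₀ (lift 1 f) (suc v) δ))
relativise-Δ₀ f v (∃⊆ y δ)  =
  ∃∈ v (and (∀∈ 0F (mem 0F (suc (suc (f y))))) (relativise-Δ₀ (lift 1 f) (suc v) δ))

lookup-lift₁ : {A : Set} {ρ : Vec A m} {ρ′ : Vec A n} {f : Fin m → Fin n} {a : A} →
               (∀ i → lookup ρ′ (f i) ≡ lookup ρ i) →
               ∀ i → lookup (a ∷ ρ′) (lift 1 f i) ≡ lookup (a ∷ ρ) i
lookup-lift₁ e zero    = refl
lookup-lift₁ e (suc i) = e i

lookup-lift₂ : {A : Set} {ρ : Vec A m} {ρ′ : Vec A n} {f : Fin m → Fin n} {a b : A} →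
               (∀ i → lookup ρ′ (f i) ≡ lookup ρ i) →
               ∀ i → lookup (a ∷ b ∷ ρ′) (lift 2 f i) ≡ lookup (a ∷ b ∷ ρ) i
lookup-lift₂ e zero          = refl
lookup-lift₂ e (suc zero)    = refl
lookup-lift₂ e (suc (suc i)) = e i

module InModel (𝓜 : Model) where
  open Model 𝓜 public

  infix 8 _⊑_
  _⊑_ : D → D → Set
  x ⊑ y = ∀ z → z ε x → z ε y

  mutual
    ⟦rename⟧⁻ : (f : Fin m → Fin n) {ρ : Vec D m} {ρ′ : Vec D n} (φ : Formula m) →
                (∀ i → lookup ρ′ (f i) ≡ lookup ρ i) → ⟦ rename f φ ⟧ ρ′ → ⟦ φ ⟧ ρ
    ⟦rename⟧⁻ f (x ∈ y) e h         = subst₂ _ε_ (e x) (e y) h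
    ⟦rename⟧⁻ f (x ≐ y) e h         = subst₂ _≈_ (e x) (e y) h
    ⟦rename⟧⁻ f ⊥ e h               = h
    ⟦rename⟧⁻ f (φ ∧ ψ) e (g , h)   = ⟦rename⟧⁻ f φ e g , ⟦rename⟧⁻ f ψ e h
    ⟦rename⟧⁻ f (φ ∨ ψ) e h noφ noψ =
      h (λ t → noφ (⟦rename⟧⁻ f φ e t)) (λ t → noψ (⟦rename⟧⁻ f ψ e t))
    ⟦rename⟧⁻ f (φ ⇒ ψ) e h t       = ⟦rename⟧⁻ f ψ e (h (⟦rename⟧ f φ e t))
    ⟦rename⟧⁻ f (∀′ φ) e h d        =
      ⟦rename⟧⁻ (lift 1 f) φ (lookup-lift₁ e) (h d)
    ⟦rename⟧⁻ f (∃′ φ) e (d , h)    =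
      d , ⟦rename⟧⁻ (lift 1 f) φ (lookup-lift₁ e) h

    ⟦rename⟧ : (f : Fin m → Fin n) {ρ : Vec D m} {ρ′ : Vec D n} (φ : Formula m) →
               (∀ i → lookup ρ′ (f i) ≡ lookup ρ i) → ⟦ φ ⟧ ρ → ⟦ rename f φ ⟧ ρ′
    ⟦rename⟧ f (x ∈ y) e h         = subst₂ _ε_ (sym (e x)) (sym (e y)) h
    ⟦rename⟧ f (x ≐ y) e h         = subst₂ _≈_ (sym (e x)) (sym (e y)) h
    ⟦rename⟧ f ⊥ e h               = h
    ⟦rename⟧ f (φ ∧ ψ) e (g , h)   = ⟦rename⟧ f φ e g , ⟦rename⟧ f ψ e h
    ⟦rename⟧ f (φ ∨ ψ) e h noφ noψ =
      h (λ t → noφ (⟦rename⟧ f φ e t)) (λ t → noψ (⟦rename⟧ f ψ e t))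
    ⟦rename⟧ f (φ ⇒ ψ) e h t       = ⟦rename⟧ f ψ e (h (⟦rename⟧⁻ f φ e t))
    ⟦rename⟧ f (∀′ φ) e h d        =
      ⟦rename⟧ (lift 1 f) φ (lookup-lift₁ e) (h d)
    ⟦rename⟧ f (∃′ φ) e (d , h)    =
      d , ⟦rename⟧ (lift 1 f) φ (lookup-lift₁ e) h

  closure-elim : ∀ n (φ : Formula n) → ⟦ closure n φ ⟧ [] → ∀ ρ → ⟦ φ ⟧ ρ
  closure-elim zero    φ h []      = h
  closure-elim (suc n) φ h (d ∷ ρ) = closure-elim n (∀′ φ) h ρ d

  closure-intro : ∀ n (φ : Formula n) → (∀ ρ → ⟦ φ ⟧ ρ) → ⟦ closure n φ ⟧ []
  closure-intro zero    φ h = h []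
  closure-intro (suc n) φ h = closure-intro n (∀′ φ) (λ ρ d → h (d ∷ ρ))

  ≈-sym : ∀ {a b} → a ≈ b → b ≈ a
  ≈-sym {a} a≈b = ≈-subst (0F ≐ 1F) (a ∷ []) a≈b ≈-refl

  ≈-subst₂ : (φ : Formula (suc (suc n))) (ρ : Vec D n) → ∀ {a a′ b b′} → a ≈ a′ → b ≈ b′ →
             ⟦ φ ⟧ (a ∷ b ∷ ρ) → ⟦ φ ⟧ (a′ ∷ b′ ∷ ρ)
  ≈-subst₂ {n} φ ρ {a} {a′} {b} {b′} a≈a′ b≈b′ t =
    ⟦rename⟧⁻ swap {ρ′ = b′ ∷ a′ ∷ ρ} φ look (≈-subst (rename swap φ) (a′ ∷ ρ) b≈b′
      (⟦rename⟧ swap φ look (≈-subst φ (b ∷ ρ) a≈a′ t)))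
    where
    swap : Fin (suc (suc n)) → Fin (suc (suc n))
    swap = 1F ∷ᶠ 0F ∷ᶠ λ i → suc (suc i)
    look : ∀ {c d} i → lookup (c ∷ d ∷ ρ) (swap i) ≡ lookup (d ∷ c ∷ ρ) i
    look zero          = refl
    look (suc zero)    = refl
    look (suc (suc i)) = refl

module InKPᴾ (𝓜 : Model) (valid : ∀ {τ} → KPᴾ τ → 𝓜 ⊨ τ) where
  open InModel 𝓜 public

  record Subset (w : D) (P : D → Set) : Set where
    constructor subset
    field
      set  : D
      ⊑w   : set ⊑ w
      out  : ∀ {x} → x ε set → P x
      into : ∀ {x} → x ε w → P x → x ε set
  open Subset public

  Δ₀-separation : {φ : Formula (suc n)} → Δ₀ φ → ∀ ρ w → Subset w (λ x → ⟦ φ ⟧ (x ∷ ρ))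
  Δ₀-separation {n} {φ} δ ρ w
    with closure-elim n _ (valid (inj₁ (inj₂ (inj₁ (Separation.inst δ))))) ρ w
  ... | y , h = subset y (λ x x∈y → proj₁ (proj₁ (h x) x∈y))
    (λ {x} x∈y → ⟦rename⟧⁻ _ φ (lookup-lift₁ λ _ → refl) (proj₂ (proj₁ (h x) x∈y)))
    (λ {x} x∈w t → proj₂ (h x) (x∈w , ⟦rename⟧ _ φ (lookup-lift₁ λ _ → refl) t))

  Δ₀ᴾ-collection : {φ : Formula (suc (suc n))} → Δ₀ᴾ φ → ∀ ρ w →
                   (∀ x → x ε w → Σ[ y ∈ D ] ⟦ φ ⟧ (y ∷ x ∷ ρ)) →
                   Σ[ C ∈ D ] ∀ x → x ε w → Σ[ y ∈ D ] y ε C × ⟦ φ ⟧ (y ∷ x ∷ ρ)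
  Δ₀ᴾ-collection {n} {φ} δ ρ w h
    with closure-elim n _ (valid (inj₂ (inj₁ (Collection.inst δ)))) ρ w
           (λ x x∈w → let y , t = h x x∈w in y , ⟦rename⟧ (lift 2 suc) φ
             (lookup-lift₂ λ _ → refl) t)
  ... | C , g = C , λ x x∈w → let y , y∈C , t = g x x∈w in y , y∈C , ⟦rename⟧⁻ _ φ
             (lookup-lift₂ λ _ → refl) t

  Π₁ᴾ-foundation : {φ : Formula (suc n)} → Π₁ᴾ φ → ∀ ρ → (Σ[ x ∈ D ] ⟦ φ ⟧ (x ∷ ρ)) →
                   Σ[ y ∈ D ] ⟦ φ ⟧ (y ∷ ρ) × (∀ x → x ε y → ⟦ φ ⟧ (x ∷ ρ) → 𝔽)
  Π₁ᴾ-foundation {n} {φ} δ ρ h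
    with closure-elim n _ (valid (inj₂ (inj₂ (Foundation.inst δ)))) ρ h
  ... | y , t , g = y , t , λ x x∈y s → g x x∈y (⟦rename⟧ (lift 1 suc) φ
    (lookup-lift₁ λ _ → refl) s)

  Δ₀ᴾ-induction : {φ : Formula (suc n)} → Δ₀ᴾ φ → ∀ ρ →
                  (∀ x → (∀ y → y ε x → ⟦ φ ⟧ (y ∷ ρ)) → ⟦ φ ⟧ (x ∷ ρ)) →
                  ∀ x → ⟦ φ ⟧ (x ∷ ρ)
  Δ₀ᴾ-induction {φ = φ} δ ρ step x = stable φ _ λ no →
    let y , noy , least = Π₁ᴾ-foundation (base (imp δ bot)) ρ (x , no)
    in noy (step y (λ z z∈y → stable φ _ (least z z∈y)))

  -- The negation of the induction statement is `Π₁ᴾ`, so a counterexample could be taken ∈-minimal.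
  Σ₁ᴾ-induction : {φ : Formula (suc (suc n))} → Δ₀ᴾ φ → ∀ ρ →
                  (∀ x → (∀ y → y ε x → Σ[ u ∈ D ] ⟦ φ ⟧ (u ∷ y ∷ ρ)) →
                         Σ[ u ∈ D ] ⟦ φ ⟧ (u ∷ x ∷ ρ)) →
                  ∀ x → Σ[ u ∈ D ] ⟦ φ ⟧ (u ∷ x ∷ ρ)
  Σ₁ᴾ-induction {φ = φ} δ ρ step x = stable (∃′ φ) (x ∷ ρ) λ no →
    let y , noy , least = Π₁ᴾ-foundation (all (base (imp δ bot))) ρ (x , λ u t → no (u , t))
        u , t = step y (λ z z∈y → stable (∃′ φ) _ λ noz → least z z∈y λ u t → noz (u , t))
    in noy u t

  irreflexive : ∀ x → x ε x → 𝔽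
  irreflexive = Δ₀ᴾ-induction {φ = 0F ∉ 0F} (imp (mem 0F 0F) bot) [] (λ x ih x∈x → ih x x∈x x∈x)

  finite : ∀ {τ} → τ ∈ˡ finiteAxioms → 𝓜 ⊨ τ
  finite i = valid (inj₁ (inj₁ i))

  ∅ : D
  ∅ = proj₁ (finite (there (here refl)))

  ⟨_,_⟩ : D → D → D
  ⟨ x , y ⟩ = proj₁ (finite (there (there (here refl))) x y)

  ∈-pair⁻ : ∀ {x y z} → z ε ⟨ x , y ⟩ → (z ≈ x → 𝔽) → (z ≈ y → 𝔽) → 𝔽
  ∈-pair⁻ {x} {y} {z} = proj₁ (proj₂ (finite (there (there (here refl))) x y) z)

  ∈-pairˡ : ∀ x y → x ε ⟨ x , y ⟩
  ∈-pairˡ x y = proj₂ (proj₂ (finite (there (there (here refl))) x y) x) (λ no _ → no ≈-refl)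

  ∈-pairʳ : ∀ x y → y ε ⟨ x , y ⟩
  ∈-pairʳ x y = proj₂ (proj₂ (finite (there (there (here refl))) x y) y) (λ _ no → no ≈-refl)

  Transitive : D → Set
  Transitive t = ∀ y → y ε t → y ⊑ t

  tc : ∀ x → Σ[ t ∈ D ] x ⊑ t × Transitive t
  tc = finite (there (there (there (there (there (there (here refl)))))))

  infixr 6 _∪_
  _∪_ : D → D → D
  x ∪ y = proj₁ (finite (there (there (there (here refl)))) ⟨ x , y ⟩)

  ∈-∪ˡ : ∀ {x y z} → z ε x → z ε (x ∪ y)
  ∈-∪ˡ {x} {y} {z} z∈x =
    proj₂ (proj₂ (finite (there (there (there (here refl)))) ⟨ x , y ⟩) z) (x , ∈-pairˡ x y , z∈x)

  ∈-∪ʳ : ∀ {x y z} → z ε y → z ε (x ∪ y)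
  ∈-∪ʳ {x} {y} {z} z∈y =
    proj₂ (proj₂ (finite (there (there (there (here refl)))) ⟨ x , y ⟩) z) (y , ∈-pairʳ x y , z∈y)

  ∈-∪⁻ : ∀ {x y z} → z ε (x ∪ y) → (z ε x → 𝔽) → (z ε y → 𝔽) → 𝔽
  ∈-∪⁻ {x} {y} {z} z∈ nox noy =
    let u , u∈ , z∈u = proj₁ (proj₂ (finite (there (there (there (here refl)))) ⟨ x , y ⟩) z) z∈
    in ∈-pair⁻ u∈ (λ u≈x → nox (≈-subst (1F ∈ 0F) (z ∷ []) u≈x z∈u))
                  (λ u≈y → noy (≈-subst (1F ∈ 0F) (z ∷ []) u≈y z∈u))

  𝒫 : D → D
  𝒫 x = proj₁ (finite (there (there (there (there (there (here refl)))))) x)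

  ∈-𝒫 : ∀ {x y} → y ⊑ x → y ε 𝒫 x
  ∈-𝒫 {x} {y} = proj₂ (proj₂ (finite (there (there (there (there (there (here refl)))))) x) y)

  ∈-𝒫⁻ : ∀ {x y} → y ε 𝒫 x → y ⊑ x
  ∈-𝒫⁻ {x} {y} = proj₁ (proj₂ (finite (there (there (there (there (there (here refl)))))) x) y)

  𝒫-transitive : ∀ {t} → Transitive t → Transitive (𝒫 t)
  𝒫-transitive tr y y∈ z z∈y = ∈-𝒫 (tr z (∈-𝒫⁻ y∈ z z∈y))

  unbounded : Σ[ I ∈ D ] (Σ[ x ∈ D ] x ε I) × (∀ x → x ε I → Σ[ y ∈ D ] y ε I × x ε y)
  unbounded with finite (there (there (there (there (there (there (there (here refl))))))))
  ... | I , (o , o∈I , _) , succ = I , (o , o∈I) , λ x x∈I →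
    let y , y∈I , h = succ x x∈I in y , y∈I , proj₂ (h x) (λ _ no → no ≈-refl)

  cover : (ρ : Vec D n) → Σ[ t ∈ D ] Transitive t × (∀ i → lookup ρ i ε t)
  cover [] = let t , _ , tr = tc ∅ in t , tr , λ ()
  cover (d ∷ ρ) with cover ρ
  ... | t , _ , c with tc ⟨ d , t ⟩
  ... | t′ , s , tr = t′ , tr , λ where
    zero    → s d (∈-pairˡ d t)
    (suc i) → tr t (s t (∈-pairʳ d t)) _ (c i)

  -- Separation for `Δ₀ᴾ` and contraction of `Σ₁ᴾ` prefixes

  infix 2 _⟺_
  _⟺_ : Set → Set → Set
  A ⟺ B = (A → B) × (B → A)

  -- One bound `u` serves all parameters from `t`. Asking only for an inclusion of `u` lets the
  -- bounds of subformulae be united, and leaving `f` and `ρ′` free lets the statement pass under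
  -- quantifiers.
  Relativised : {φ : Formula n} → Δ₀ᴾ φ → D → D → Set
  Relativised {n} {φ} δ t u =
    ∀ {m} (ρ : Vec D n) → (∀ i → lookup ρ i ε t) →
    (f : Fin n → Fin m) (v : Fin m) (ρ′ : Vec D m) → (∀ i → lookup ρ′ (f i) ≡ lookup ρ i) →
    u ⊑ lookup ρ′ v → (⟦ φ ⟧ ρ ⟺ ⟦ relativise f v δ ⟧ ρ′)

  relativised-⊑ : {φ : Formula n} (δ : Δ₀ᴾ φ) {t u u′ : D} → u ⊑ u′ →
                  Relativised δ t u → Relativised δ t u′
  relativised-⊑ δ u⊑u′ h ρ c f v ρ′ e u′⊑v = h ρ c f v ρ′ e (λ z z∈u → u′⊑v z (u⊑u′ z z∈u))

  relativised-under :
    {φ : Formula (suc n)} (δ : Δ₀ᴾ φ) {t u : D} → Relativised δ t u →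
    (ρ : Vec D n) → (∀ i → lookup ρ i ε t) →
    (f : Fin n → Fin m) (v : Fin m) (ρ′ : Vec D m) → (∀ i → lookup ρ′ (f i) ≡ lookup ρ i) →
    u ⊑ lookup ρ′ v → ∀ d → d ε t →
    (⟦ φ ⟧ (d ∷ ρ) ⟺ ⟦ relativise (lift 1 f) (suc v) δ ⟧ (d ∷ ρ′))
  relativised-under δ h ρ c f v ρ′ e u⊑v d d∈t =
    h (d ∷ ρ) (λ { zero → d∈t ; (suc i) → c i }) (lift 1 f) (suc v) (d ∷ ρ′) (lookup-lift₁ e) u⊑v

  -- A bound for the relativisation at parameters from t: every ⊆-quantifier adds one
  -- power set to t.
  relativise-correct : {φ : Formula n} (δ : Δ₀ᴾ φ) {t : D} → Transitive t →
                       Σ[ u ∈ D ] Relativised δ t u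
  relativise-correct (mem x y) {t} tr = t , λ where
    ρ c f v ρ′ e _ → subst₂ _ε_ (sym (e x)) (sym (e y)) , subst₂ _ε_ (e x) (e y)
  relativise-correct (eq x y) {t} tr = t , λ where
    ρ c f v ρ′ e _ → subst₂ _≈_ (sym (e x)) (sym (e y)) , subst₂ _≈_ (e x) (e y)
  relativise-correct bot {t} tr = t , λ where
    ρ c f v ρ′ e _ → id , id
  relativise-correct (and δ δ′) tr with relativise-correct δ tr | relativise-correct δ′ tr
  ... | u , h | u′ , h′ = u ∪ u′ , λ ρ c f v ρ′ e ⊑v →
    let to  , from  = relativised-⊑ δ (λ _ → ∈-∪ˡ) h ρ c f v ρ′ e ⊑v
        to′ , from′ = relativised-⊑ δ′ (λ _ → ∈-∪ʳ) h′ ρ c f v ρ′ e ⊑v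
    in (λ (s , t) → to s , to′ t) , (λ (s , t) → from s , from′ t)
  relativise-correct (or δ δ′) tr with relativise-correct δ tr | relativise-correct δ′ tr
  ... | u , h | u′ , h′ = u ∪ u′ , λ ρ c f v ρ′ e ⊑v →
    let to  , from  = relativised-⊑ δ (λ _ → ∈-∪ˡ) h ρ c f v ρ′ e ⊑v
        to′ , from′ = relativised-⊑ δ′ (λ _ → ∈-∪ʳ) h′ ρ c f v ρ′ e ⊑v
    in (λ s no no′ → s (no ∘ to) (no′ ∘ to′)) , (λ s no no′ → s (no ∘ from) (no′ ∘ from′))
  relativise-correct (imp δ δ′) tr with relativise-correct δ tr | relativise-correct δ′ tr
  ... | u , h | u′ , h′ = u ∪ u′ , λ ρ c f v ρ′ e ⊑v →
    let to  , from  = relativised-⊑ δ (λ _ → ∈-∪ˡ) h ρ c f v ρ′ e ⊑v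
        to′ , from′ = relativised-⊑ δ′ (λ _ → ∈-∪ʳ) h′ ρ c f v ρ′ e ⊑v
    in (λ s → to′ ∘ s ∘ from) , (λ s → from′ ∘ s ∘ to)
  relativise-correct (∀∈ y δ) tr with relativise-correct δ tr
  ... | u , h = u , λ ρ c f v ρ′ e ⊑v →
    let iff = λ d d∈y → relativised-under δ h ρ c f v ρ′ e ⊑v d (tr _ (c y) d d∈y)
    in (λ s d d∈ → let d∈y = subst (d ε_) (e y) d∈ in proj₁ (iff d d∈y) (s d d∈y)) ,
       (λ s d d∈y → proj₂ (iff d d∈y) (s d (subst (d ε_) (sym (e y)) d∈y)))
  relativise-correct (∃∈ y δ) tr with relativise-correct δ tr
  ... | u , h = u , λ ρ c f v ρ′ e ⊑v →
    let iff = λ d d∈y → relativised-under δ h ρ c f v ρ′ e ⊑v d (tr _ (c y) d d∈y)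
    in (λ (d , d∈y , s) → d , subst (d ε_) (sym (e y)) d∈y , proj₁ (iff d d∈y) s) ,
       (λ (d , d∈ , s) → let d∈y = subst (d ε_) (e y) d∈ in d , d∈y , proj₂ (iff d d∈y) s)
  relativise-correct (∀⊆ y δ) {t} tr with relativise-correct δ (𝒫-transitive tr)
  ... | u , h = u ∪ 𝒫 t , λ ρ c f v ρ′ e ⊑v →
    let small = λ d d⊑y → ∈-𝒫 (λ z z∈d → tr _ (c y) z (d⊑y z z∈d))
        iff = λ d d⊑y → relativised-under δ (relativised-⊑ δ (λ _ → ∈-∪ˡ) h)
                ρ (λ i → ∈-𝒫 (tr _ (c i))) f v ρ′ e ⊑v d (small d d⊑y)
    in (λ s d _ d⊑ → let d⊑y = subst (d ⊑_) (e y) d⊑ in proj₁ (iff d d⊑y) (s d d⊑y)) ,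
       (λ s d d⊑y → proj₂ (iff d d⊑y)
         (s d (⊑v d (∈-∪ʳ (small d d⊑y))) (subst (d ⊑_) (sym (e y)) d⊑y)))
  relativise-correct (∃⊆ y δ) {t} tr with relativise-correct δ (𝒫-transitive tr)
  ... | u , h = u ∪ 𝒫 t , λ ρ c f v ρ′ e ⊑v →
    let small = λ d d⊑y → ∈-𝒫 (λ z z∈d → tr _ (c y) z (d⊑y z z∈d))
        iff = λ d d⊑y → relativised-under δ (relativised-⊑ δ (λ _ → ∈-∪ˡ) h)
                ρ (λ i → ∈-𝒫 (tr _ (c i))) f v ρ′ e ⊑v d (small d d⊑y)
    in (λ (d , d⊑y , s) → d , ⊑v d (∈-∪ʳ (small d d⊑y)) , subst (d ⊑_) (sym (e y)) d⊑y ,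
                          proj₁ (iff d d⊑y) s) ,
       (λ (d , _ , d⊑ , s) → let d⊑y = subst (d ⊑_) (e y) d⊑ in d , d⊑y , proj₂ (iff d d⊑y) s)

  -- `Δ₀`-Separation is applied to the relativised formula with the bound `u` as an extra parameter.
  -- Since `w` lies in the transitive `t`, so does every candidate `x`, and one `u` works for all.
  Δ₀ᴾ-separation : {φ : Formula (suc n)} → Δ₀ᴾ φ → ∀ ρ w → Subset w (λ x → ⟦ φ ⟧ (x ∷ ρ))
  Δ₀ᴾ-separation {n} {φ} δ ρ w with cover (w ∷ ρ)
  ... | t , tr , c with relativise-correct δ tr
  ... | u , correct = subset (set s) (⊑w s)
      (λ x∈s → proj₂ (iff (⊑w s _ x∈s)) (out s x∈s))
      (λ x∈w h → into s x∈w (proj₁ (iff x∈w) h))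
    where
    s : Subset w (λ x → ⟦ relativise (lift 1 suc) 1F δ ⟧ (x ∷ u ∷ ρ))
    s = Δ₀-separation (relativise-Δ₀ (lift 1 suc) 1F δ) (u ∷ ρ) w
    iff : ∀ {x} → x ε w → (⟦ φ ⟧ (x ∷ ρ) ⟺ ⟦ relativise (lift 1 suc) 1F δ ⟧ (x ∷ u ∷ ρ))
    iff {x} x∈w = correct (x ∷ ρ) (λ { zero → tr w (c zero) x x∈w ; (suc i) → c (suc i) })
      (lift 1 suc) 1F (x ∷ u ∷ ρ) (lookup-lift₁ λ _ → refl) (λ _ → id)

  -- Two witnesses `x` and `y` are gathered into one set and recovered by bounded quantifiers. An
  -- unordered pair is enough, because any set with suitable members gives the converse.
  Σ₁ᴾ-contract : {φ : Formula n} → Σ₁ᴾ φ →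
    Σ[ ψ ∈ Formula (suc n) ] Δ₀ᴾ ψ × (∀ ρ → ⟦ φ ⟧ ρ ⟺ (Σ[ d ∈ D ] ⟦ ψ ⟧ (d ∷ ρ)))
  Σ₁ᴾ-contract {φ = φ} (base δ) = weaken φ , Δ₀ᴾ-rename suc δ , λ ρ →
    (λ h → ∅ , ⟦rename⟧ suc φ (λ _ → refl) h) , (λ (d , h) → ⟦rename⟧⁻ suc φ (λ _ → refl) h)
  Σ₁ᴾ-contract (ex s) with Σ₁ᴾ-contract s
  ... | ψ , δ , iff =
    (∃∈[ 0F ] ∃∈[ 1F ] rename (lift 2 suc) ψ) ,
    ∃∈ 0F (∃∈ 1F (Δ₀ᴾ-rename (lift 2 suc) δ)) , λ ρ →
    (λ (x , h) → let y , h′ = proj₁ (iff _) h in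
      ⟨ x , y ⟩ , x , ∈-pairˡ x y , y , ∈-pairʳ x y ,
      ⟦rename⟧ (lift 2 suc) ψ (lookup-lift₂ λ _ → refl) h′) ,
    (λ (u , x , _ , y , _ , h) → x , proj₂ (iff _) (y ,
      ⟦rename⟧⁻ (lift 2 suc) ψ (lookup-lift₂ λ _ → refl) h))

-- The cumulative hierarchy

-- a = { x : x ⊆ c for some c ∈ h ∩ a }
accumulatesᶠ : (a h : Fin n) → Formula n
accumulatesᶠ a h =
  (∀∈[ a ] ∃∈[ suc h ] 0F ∈ suc (suc a) ∧ 1F ⊆ 0F) ∧
  (∀∈[ h ] 0F ∈ suc a ⇒ (∀⊆[ 0F ] 0F ∈ suc (suc a)))

accumulates-Δ₀ᴾ : (a h : Fin n) → Δ₀ᴾ (accumulatesᶠ a h)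
accumulates-Δ₀ᴾ a h =
  and (∀∈ a (∃∈ (suc h) (and (mem 0F (suc (suc a))) (⊆-Δ₀ᴾ 1F 0F))))
      (∀∈ h (imp (mem 0F (suc a)) (∀⊆ 0F (mem 0F (suc (suc a))))))

-- The stages V_α defined without ordinals, in the style of Scott and Potter: `s` is accumulated
-- from a set of earlier levels, each accumulated from its own predecessors in that set. Bounding
-- the history by `s` makes the notion `Δ₀ᴾ`.
levelᶠ : (s : Fin n) → Formula n
levelᶠ s = ∃⊆[ s ] (∀∈[ 0F ] accumulatesᶠ 0F 1F) ∧ accumulatesᶠ (suc s) 0F

level-Δ₀ᴾ : (s : Fin n) → Δ₀ᴾ (levelᶠ s)
level-Δ₀ᴾ s = ∃⊆ s (and (∀∈ 0F (accumulates-Δ₀ᴾ 0F 1F)) (accumulates-Δ₀ᴾ (suc s) 0F))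

module Levels (𝓜 : Model) (valid : ∀ {τ} → KPᴾ τ → 𝓜 ⊨ τ) where
  open InKPᴾ 𝓜 valid public

  Accumulates : D → D → Set
  Accumulates a h =
    (∀ x → x ε a → Σ[ c ∈ D ] c ε h × c ε a × x ⊑ c) ×
    (∀ c → c ε h → c ε a → ∀ x → x ⊑ c → x ε a)

  History : D → Set
  History h = ∀ a → a ε h → Accumulates a h

  Level : D → Set
  Level s = Σ[ h ∈ D ] h ⊑ s × History h × Accumulates s h

  accumulates-transitive : ∀ {s h} → Accumulates s h →
                           (∀ c → c ε h → c ε s → Transitive c) → Transitive s
  accumulates-transitive (down , up) tr b b∈s x x∈b =
    let c , c∈h , c∈s , b⊑c = down b b∈s
    in up c c∈h c∈s x (tr c c∈h c∈s x (b⊑c x x∈b))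

  history-transitive : ∀ {h} → History h → ∀ a → a ε h → Transitive a
  history-transitive {h} hist = Δ₀ᴾ-induction {φ = 0F ∈ 1F ⇒ (∀∈[ 0F ] 0F ⊆ 1F)}
    (imp (mem 0F 1F) (∀∈ 0F (⊆-Δ₀ᴾ 0F 1F))) (h ∷ [])
    (λ a ih a∈h → accumulates-transitive (hist a a∈h) (λ c c∈h c∈a → ih c c∈a c∈h))

  level-transitive : ∀ {s} → Level s → Transitive s
  level-transitive (h , _ , hist , acc) =
    accumulates-transitive acc (λ c c∈h _ → history-transitive hist c c∈h)

  -- The history is `h` cut down to `a`. As `a` is transitive, the cut removes nothing used to
  -- accumulate `a` or the members of `h` below it.
  history-level : ∀ {h} → History h → ∀ a → a ε h → Level a
  history-level {h} hist a a∈h =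
    set h∩a , (λ b → out h∩a) ,
    (λ b b∈ → cut (λ c c∈b → history-transitive hist a a∈h b (out h∩a b∈) c c∈b)
                  (hist b (⊑w h∩a b b∈))) ,
    cut (λ c → id) (hist a a∈h)
    where
    h∩a : Subset h (_ε a)
    h∩a = Δ₀-separation {φ = 0F ∈ 1F} (mem 0F 1F) (a ∷ []) h
    cut : ∀ {b} → b ⊑ a → Accumulates b h → Accumulates b (set h∩a)
    cut b⊑a (down , up) =
      (λ x x∈b → let c , c∈h , c∈b , x⊑c = down x x∈b in c , into h∩a c∈h (b⊑a c c∈b) , c∈b , x⊑c) ,
      (λ c c∈ → up c (⊑w h∩a c c∈))

  level-below : ∀ {s} → Level s → ∀ x → x ε s → Σ[ V ∈ D ] V ε s × Level V × x ⊑ V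
  level-below (h , _ , hist , down , _) x x∈s =
    let c , c∈h , c∈s , x⊑c = down x x∈s in c , c∈s , history-level hist c c∈h , x⊑c

  level-potent : ∀ {s} → Level s → ∀ c → c ε s → ∀ x → x ⊑ c → x ε s
  level-potent (h , _ , _ , down , up) c c∈s x x⊑c =
    let b , b∈h , b∈s , c⊑b = down c c∈s in up b b∈h b∈s x (λ z z∈x → c⊑b z (x⊑c z z∈x))

  Comparable : D → D → Set
  Comparable V W = (W ε V → 𝔽) → V ⊑ W

  -- A double ∈-induction, on `A` outside and on `B` inside, for both directions at once. Confining
  -- `B` to a transitive set around `W` keeps the outer induction formula `Δ₀ᴾ`.
  comparable : ∀ {V W} → Level V → Level W → Comparable V W
  comparable {V} {W} lV lW = proj₁ (outer V lV W (W⊑t W (∈-pairˡ W W)) lW)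
    where
    -- `tc` yields a superset only; passing to the singleton makes `W` an element.
    t = proj₁ (tc ⟨ W , W ⟩)
    W⊑t = proj₁ (proj₂ (tc ⟨ W , W ⟩))
    t-tr = proj₂ (proj₂ (tc ⟨ W , W ⟩))

    -- For a level `U` in `A`, transitivity of `A` rules out that `B` is in `U`, so `U ⊑ B`. Were
    -- `U` not in `B`, then `B ⊑ U` would put `B` into `A`. Hence `U` is in `B`, and with it every
    -- subset of `U`.
    step : ∀ {A B} → Level A → Level B →
           (∀ U → U ε A → Level U → Comparable U B × Comparable B U) → Comparable A B
    step {A} {B} lA lB ih B∉A x x∈A with level-below lA x x∈A
    ... | U , U∈A , lU , x⊑U = level-potent lB U U∈B x x⊑U
      where
      U⊑B : U ⊑ B
      U⊑B = proj₁ (ih U U∈A lU) (λ B∈U → B∉A (level-transitive lA U U∈A B B∈U))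
      U∈B : U ε B
      U∈B = stable (0F ∈ 1F) (U ∷ B ∷ []) λ U∉B →
        B∉A (level-potent lA U U∈A B (proj₂ (ih U U∈A lU) U∉B))

    outer : ∀ A → Level A → ∀ B → B ε t → Level B → Comparable A B × Comparable B A
    outer = Δ₀ᴾ-induction
      {φ = levelᶠ 0F ⇒ (∀∈[ 1F ] levelᶠ 0F ⇒ ((0F ∉ 1F ⇒ 1F ⊆ 0F) ∧ (1F ∉ 0F ⇒ 0F ⊆ 1F)))}
      (imp (level-Δ₀ᴾ 0F) (∀∈ 1F (imp (level-Δ₀ᴾ 0F)
        (and (imp (imp (mem 0F 1F) bot) (⊆-Δ₀ᴾ 1F 0F)) (imp (imp (mem 1F 0F) bot) (⊆-Δ₀ᴾ 0F 1F))))))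
      (t ∷ [])
      (λ A ih lA B B∈t lB →
        let A≼ : ∀ B → B ε t → Level B → Comparable A B
            A≼ B B∈t lB = step lA lB (λ U U∈A lU → ih U U∈A lU B B∈t lB)
            inner : ∀ B → B ε t → Level B → Comparable B A
            inner = Δ₀ᴾ-induction {φ = 0F ∈ 1F ⇒ levelᶠ 0F ⇒ 2F ∉ 0F ⇒ 0F ⊆ 2F}
              (imp (mem 0F 1F) (imp (level-Δ₀ᴾ 0F) (imp (imp (mem 2F 0F) bot) (⊆-Δ₀ᴾ 0F 2F))))
              (t ∷ A ∷ [])
              (λ B ih′ B∈t lB → step lB lA (λ U U∈B lU →
                ih′ U U∈B (t-tr B B∈t U U∈B) lU , A≼ U (t-tr B B∈t U U∈B) lU))
        in A≼ B B∈t lB , inner B B∈t lB)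

  -- By induction the members of `x` are included in levels, which Collection gathers. The next
  -- level above all of these has every member of `x` as an element.
  level-⊒ : ∀ x → Σ[ W ∈ D ] Level W × x ⊑ W
  level-⊒ = Σ₁ᴾ-induction {φ = levelᶠ 0F ∧ 1F ⊆ 0F} (and (level-Δ₀ᴾ 0F) (⊆-Δ₀ᴾ 1F 0F)) [] step
    where
    step : ∀ x → (∀ y → y ε x → Σ[ W ∈ D ] Level W × y ⊑ W) → Σ[ W ∈ D ] Level W × x ⊑ W
    step x ih = set s , (set h , h⊑s , hist , acc) , x⊑s
      where
      collected = Δ₀ᴾ-collection {φ = levelᶠ 0F ∧ 1F ⊆ 0F}
        (and (level-Δ₀ᴾ 0F) (⊆-Δ₀ᴾ 1F 0F)) [] x ih
      C = proj₁ collected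
      t = proj₁ (tc C)
      C⊑t = proj₁ (proj₂ (tc C))
      t-tr = proj₂ (proj₂ (tc C))
      -- Taking all levels in the transitive `t`, not just the collected ones, gives `h` the earlier
      -- levels of each member, as a history requires.
      h : Subset t Level
      h = Δ₀ᴾ-separation {φ = levelᶠ 0F} (level-Δ₀ᴾ 0F) [] t
      s : Subset (𝒫 t) (λ z → Σ[ c ∈ D ] c ε set h × z ⊑ c)
      s = Δ₀ᴾ-separation {φ = ∃∈[ 1F ] 1F ⊆ 0F} (∃∈ 1F (⊆-Δ₀ᴾ 1F 0F)) (set h ∷ []) (𝒫 t)
      ⊑level⇒∈s : ∀ {c z} → c ε set h → z ⊑ c → z ε set s
      ⊑level⇒∈s {c} c∈h z⊑c =
        into s (∈-𝒫 (λ u u∈z → t-tr c (⊑w h c c∈h) u (z⊑c u u∈z))) (c , c∈h , z⊑c)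
      h⊑s : set h ⊑ set s
      h⊑s c c∈h = ⊑level⇒∈s c∈h (λ _ → id)
      hist : History (set h)
      hist a a∈h =
        (λ x x∈a → let V , V∈a , lV , x⊑V = level-below (out h a∈h) x x∈a
                   in V , into h (t-tr a (⊑w h a a∈h) V V∈a) lV , V∈a , x⊑V) ,
        (λ c _ → level-potent (out h a∈h) c)
      acc : Accumulates (set s) (set h)
      acc = (λ z z∈s → let c , c∈h , z⊑c = out s z∈s in c , c∈h , h⊑s c c∈h , z⊑c) ,
            (λ c c∈h _ z → ⊑level⇒∈s c∈h)
      x⊑s : x ⊑ set s
      x⊑s y y∈x = let W , W∈C , lW , y⊑W = proj₂ collected y y∈x
                  in ⊑level⇒∈s (into h (C⊑t W W∈C) lW) y⊑W

  least-level : {φ : Formula (suc n)} → Δ₀ᴾ φ → ∀ ρ → (Σ[ W ∈ D ] Level W × ⟦ φ ⟧ (W ∷ ρ)) →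
                Σ[ W ∈ D ] Level W × ⟦ φ ⟧ (W ∷ ρ) × (∀ V → V ε W → Level V → ⟦ φ ⟧ (V ∷ ρ) → 𝔽)
  least-level {φ = φ} δ ρ h =
    let W , (lW , t) , least = Π₁ᴾ-foundation {φ = levelᶠ 0F ∧ φ} (base (and (level-Δ₀ᴾ 0F) δ)) ρ h
    in W , lW , t , λ V V∈W lV s → least V V∈W (lV , s)

-- Foundation for Σ₁ᴾ

module Descent
  (𝓜 : Model) (valid : ∀ {τ} → KPᴾ τ → 𝓜 ⊨ τ)
  {n : ℕ} {ψ : Formula (suc (suc n))} (δ : Δ₀ᴾ ψ) (ρ : Vec (Model.D 𝓜) n)
  where
  open Levels 𝓜 valid

  Ψ : D → D → Set
  Ψ y x = ⟦ ψ ⟧ (y ∷ x ∷ ρ)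

  module Absurdity
    (descend : ∀ x y → Ψ y x → Σ[ x′ ∈ D ] x′ ε x × Σ[ y′ ∈ D ] Ψ y′ x′)
    (x₀ y₀ : D) (ψ₀ : Ψ y₀ x₀)
    where

    X = proj₁ (tc ⟨ x₀ , x₀ ⟩)

    x₀∈X : x₀ ε X
    x₀∈X = proj₁ (proj₂ (tc ⟨ x₀ , x₀ ⟩)) x₀ (∈-pairˡ x₀ x₀)

    X-transitive : Transitive X
    X-transitive = proj₂ (proj₂ (tc ⟨ x₀ , x₀ ⟩))

    params : Vec D (suc (suc n))
    params = X ∷ y₀ ∷ ρ

    -- Steps and certificates

    Step : D → D → Set
    Step C C′ = ∀ x → x ε X → (Σ[ y ∈ D ] y ⊑ C × Ψ y x) →
                Σ[ x′ ∈ D ] x′ ε x × Σ[ y ∈ D ] y ⊑ C′ × Ψ y x′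

    stepᶠ : Formula (4 + n)
    stepᶠ = ∀∈[ 2F ] (∃⊆[ 1F ] rename (lift 2 (4 ↑ʳ_)) ψ)
                     ⇒ (∃∈[ 0F ] ∃⊆[ 3F ] rename (lift 2 (5 ↑ʳ_)) ψ)

    step-Δ₀ᴾ : Δ₀ᴾ stepᶠ
    step-Δ₀ᴾ = ∀∈ 2F (imp (∃⊆ 1F (Δ₀ᴾ-rename _ δ)) (∃∈ 0F (∃⊆ 3F (Δ₀ᴾ-rename _ δ))))

    step⇒ : ∀ {C C′} → Step C C′ → ⟦ stepᶠ ⟧ (C ∷ C′ ∷ params)
    step⇒ h x x∈X (y , y⊑C , t) =
      let x′ , x′∈x , y′ , y′⊑C′ , t′ =
            h x x∈X (y , y⊑C , ⟦rename⟧⁻ _ ψ (lookup-lift₂ λ _ → refl) t)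
      in x′ , x′∈x , y′ , y′⊑C′ , ⟦rename⟧ _ ψ (lookup-lift₂ λ _ → refl) t′

    step⇐ : ∀ {C C′} → ⟦ stepᶠ ⟧ (C ∷ C′ ∷ params) → Step C C′
    step⇐ h x x∈X (y , y⊑C , t) =
      let x′ , x′∈x , y′ , y′⊑C′ , t′ =
            h x x∈X (y , y⊑C , ⟦rename⟧ _ ψ (lookup-lift₂ λ _ → refl) t)
      in x′ , x′∈x , y′ , y′⊑C′ , ⟦rename⟧⁻ _ ψ (lookup-lift₂ λ _ → refl) t′

    -- What is collected is conditional: `u` witnesses some `x′ ε x` provided `x` has a witness
    -- included in `C`. Each collected `u` is then a subset of the transitive `t`.
    step-exists : ∀ C → Σ[ C′ ∈ D ] Step C C′
    step-exists C = t , λ x x∈X (y , y⊑C , h) →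
      let u , u∈S , f = proj₂ collected x x∈X
          x′ , x′∈x , h′ = f (y , y⊑C , ⟦rename⟧ r₁ ψ look₁ h)
      in x′ , x′∈x , u , t-tr u (S⊑t u u∈S) , ⟦rename⟧⁻ r₂ ψ look₂ h′
      where
      r₁ r₂ : Fin (2 + n) → Fin (4 + n)
      r₁ = 0F ∷ᶠ 2F ∷ᶠ (4 ↑ʳ_)
      r₂ = 1F ∷ᶠ 0F ∷ᶠ (4 ↑ʳ_)
      look₁ : ∀ {y u x} i → lookup (y ∷ u ∷ x ∷ C ∷ ρ) (r₁ i) ≡ lookup (y ∷ x ∷ ρ) i
      look₁ zero          = refl
      look₁ (suc zero)    = refl
      look₁ (suc (suc i)) = refl
      look₂ : ∀ {x′ u x} i → lookup (x′ ∷ u ∷ x ∷ C ∷ ρ) (r₂ i) ≡ lookup (u ∷ x′ ∷ ρ) i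
      look₂ zero          = refl
      look₂ (suc zero)    = refl
      look₂ (suc (suc i)) = refl
      improveᶠ = (∃⊆[ 2F ] rename r₁ ψ) ⇒ (∃∈[ 1F ] rename r₂ ψ)
      collected : Σ[ S ∈ D ] ∀ x → x ε X → Σ[ u ∈ D ] u ε S × ⟦ improveᶠ ⟧ (u ∷ x ∷ C ∷ ρ)
      collected = Δ₀ᴾ-collection {φ = improveᶠ}
        (imp (∃⊆ 2F (Δ₀ᴾ-rename _ δ)) (∃∈ 1F (Δ₀ᴾ-rename _ δ))) (C ∷ ρ) X
        -- Whether `x` has a witness included in `C` cannot be decided. So `∅` is offered first, and
        -- a witness brought against it goes to `descend`, whose `y′` is the second offer.
        (λ x _ → stable (∃′ improveᶠ) (x ∷ C ∷ ρ) λ no → no (∅ , λ (y , _ , h) →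
          let x′ , x′∈x , y′ , h′ = descend x y (⟦rename⟧⁻ r₁ ψ look₁ h)
          in stable (∃∈[ 1F ] rename r₂ ψ) (∅ ∷ x ∷ C ∷ ρ) λ _ →
             no (y′ , λ _ → x′ , x′∈x , ⟦rename⟧ r₂ ψ look₂ h′)))
      S = proj₁ collected
      t = proj₁ (tc S)
      S⊑t = proj₁ (proj₂ (tc S))
      t-tr = proj₂ (proj₂ (tc S))

    -- The condition on a pair `(x,W)` of `h`. The clause on `y₀` later places the initial witness
    -- inside the limit level.
    Entry : D → D → D → Set
    Entry W x h = Level W × y₀ ε W × ∀ z → z ε x →
      Σ[ p ∈ D ] p ε h × z ε p × Σ[ W′ ∈ D ] W′ ε p × z ε W′ × Step W′ W

    entryᶠ : Formula (5 + n)
    entryᶠ = levelᶠ 0F ∧ 4F ∈ 0F ∧ (∀∈[ 1F ] ∃∈[ 3F ] 1F ∈ 0F ∧ (∃∈[ 0F ] 2F ∈ 0F ∧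
      rename (0F ∷ᶠ 3F ∷ᶠ (6 ↑ʳ_)) stepᶠ))

    entry-Δ₀ᴾ : Δ₀ᴾ entryᶠ
    entry-Δ₀ᴾ = and (level-Δ₀ᴾ 0F) (and (mem 4F 0F) (∀∈ 1F (∃∈ 3F (and (mem 1F 0F)
      (∃∈ 0F (and (mem 2F 0F) (Δ₀ᴾ-rename _ step-Δ₀ᴾ)))))))

    look-entry : ∀ {a b c d e f} (i : Fin (4 + n)) →
      lookup (a ∷ b ∷ c ∷ d ∷ e ∷ f ∷ params) ((0F ∷ᶠ 3F ∷ᶠ (6 ↑ʳ_)) i) ≡ lookup (a ∷ d ∷ params) i
    look-entry zero          = refl
    look-entry (suc zero)    = refl
    look-entry (suc (suc i)) = refl

    entry⇒ : ∀ {W x h} → Entry W x h → ⟦ entryᶠ ⟧ (W ∷ x ∷ h ∷ params)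
    entry⇒ {W} {x} {h} (lW , y₀∈W , f) = lW , y₀∈W , λ z z∈x →
      let p , p∈h , z∈p , W′ , W′∈p , z∈W′ , s = f z z∈x
      in p , p∈h , z∈p , W′ , W′∈p , z∈W′ ,
         ⟦rename⟧ _ {W′ ∷ W ∷ params} {W′ ∷ p ∷ z ∷ W ∷ x ∷ h ∷ params} stepᶠ look-entry (step⇒ s)

    entry⇐ : ∀ {W x h} → ⟦ entryᶠ ⟧ (W ∷ x ∷ h ∷ params) → Entry W x h
    entry⇐ {W} {x} {h} (lW , y₀∈W , f) = lW , y₀∈W , λ z z∈x →
      let p , p∈h , z∈p , W′ , W′∈p , z∈W′ , s = f z z∈x
      in p , p∈h , z∈p , W′ , W′∈p , z∈W′ , step⇐
         (⟦rename⟧⁻ _ {W′ ∷ W ∷ params} {W′ ∷ p ∷ z ∷ W ∷ x ∷ h ∷ params} stepᶠ look-entry s)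

    -- The pair (x,W), where x ∈ W, is represented by any p ∈ h containing both x and W.
    Certificate : D → Set
    Certificate h = ∀ p → p ε h → ∀ x → x ε p → ∀ W → W ε p → x ε W → Entry W x h

    certificateᶠ : Formula (3 + n)
    certificateᶠ = ∀∈[ 0F ] ∀∈[ 0F ] ∀∈[ 1F ] 1F ∈ 0F ⇒ rename (lift 2 suc) entryᶠ

    certificate-Δ₀ᴾ : Δ₀ᴾ certificateᶠ
    certificate-Δ₀ᴾ = ∀∈ 0F (∀∈ 0F (∀∈ 1F (imp (mem 1F 0F) (Δ₀ᴾ-rename _ entry-Δ₀ᴾ))))

    certificate⇒ : ∀ {h} → Certificate h → ⟦ certificateᶠ ⟧ (h ∷ params)
    certificate⇒ {h} c p p∈h x x∈p W W∈p x∈W =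
      ⟦rename⟧ _ {W ∷ x ∷ h ∷ params} {W ∷ x ∷ p ∷ h ∷ params} entryᶠ
        (lookup-lift₂ λ _ → refl) (entry⇒ (c p p∈h x x∈p W W∈p x∈W))

    certificate⇐ : ∀ {h} → ⟦ certificateᶠ ⟧ (h ∷ params) → Certificate h
    certificate⇐ {h} c p p∈h x x∈p W W∈p x∈W =
      entry⇐ (⟦rename⟧⁻ _ {W ∷ x ∷ h ∷ params} {W ∷ x ∷ p ∷ h ∷ params} entryᶠ
        (lookup-lift₂ λ _ → refl) (c p p∈h x x∈p W W∈p x∈W))

    entry-mono : ∀ {W x h h′} → h ⊑ h′ → Entry W x h → Entry W x h′
    entry-mono h⊑h′ (lW , y₀∈W , f) = lW , y₀∈W , λ z z∈x →
      let p , p∈h , rest = f z z∈x in p , h⊑h′ p p∈h , rest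

    Reaches : D → D → Set
    Reaches h x = Certificate h × Σ[ p ∈ D ] p ε h × x ε p × Σ[ W ∈ D ] W ε p × x ε W

    reachesᶠ : Formula (4 + n)
    reachesᶠ = rename (lift 1 suc) certificateᶠ ∧ (∃∈[ 0F ] 2F ∈ 0F ∧ (∃∈[ 0F ] 3F ∈ 0F))

    reaches-Δ₀ᴾ : Δ₀ᴾ reachesᶠ
    reaches-Δ₀ᴾ = and (Δ₀ᴾ-rename _ certificate-Δ₀ᴾ)
      (∃∈ 0F (and (mem 2F 0F) (∃∈ 0F (mem 3F 0F))))

    reaches⇒ : ∀ {h x} → Reaches h x → ⟦ reachesᶠ ⟧ (h ∷ x ∷ params)
    reaches⇒ {h} {x} (c , rest) =
      ⟦rename⟧ _ {h ∷ params} {h ∷ x ∷ params} certificateᶠ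
        (lookup-lift₁ λ _ → refl) (certificate⇒ c) , rest

    reaches⇐ : ∀ {h x} → ⟦ reachesᶠ ⟧ (h ∷ x ∷ params) → Reaches h x
    reaches⇐ {h} {x} (c , rest) =
      certificate⇐ (⟦rename⟧⁻ _ {h ∷ params} {h ∷ x ∷ params} certificateᶠ
        (lookup-lift₁ λ _ → refl) c) , rest

    -- All certificates in a transitive `t` around the collected ones are united, so none has to be
    -- chosen, and one pair `(x,W)` is added. Each `W′` of an old pair is included in `t`, so a
    -- single step out of `t` serves them all.
    reach : ∀ x → Σ[ h ∈ D ] Reaches h x
    reach x = let h , r = Σ₁ᴾ-induction reaches-Δ₀ᴾ params step x in h , reaches⇐ r
      where
      step : ∀ x → (∀ y → y ε x → Σ[ h ∈ D ] ⟦ reachesᶠ ⟧ (h ∷ y ∷ params)) →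
             Σ[ h ∈ D ] ⟦ reachesᶠ ⟧ (h ∷ x ∷ params)
      step x ih = h⁺ , reaches⇒ (cert⁺ , q , q∈h⁺ , ∈-pairˡ x W , W , ∈-pairʳ x W , x∈W)
        where
        collected = Δ₀ᴾ-collection reaches-Δ₀ᴾ params x ih
        S = proj₁ collected
        t = proj₁ (tc S)
        S⊑t = proj₁ (proj₂ (tc S))
        t-tr = proj₂ (proj₂ (tc S))
        C = proj₁ (step-exists t)
        -- `W` must include the target `C` of that step, contain `x` for the coding of pairs, and
        -- contain `y₀` for `Entry`.
        above = level-⊒ ⟨ C , ⟨ x , y₀ ⟩ ⟩
        W = proj₁ above
        lW = proj₁ (proj₂ above)
        C∈W : C ε W
        C∈W = proj₂ (proj₂ above) C (∈-pairˡ _ _)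
        xy₀∈W : ⟨ x , y₀ ⟩ ε W
        xy₀∈W = proj₂ (proj₂ above) _ (∈-pairʳ _ _)
        x∈W : x ε W
        x∈W = level-transitive lW _ xy₀∈W x (∈-pairˡ _ _)
        q = ⟨ x , W ⟩
        inCertificateᶠ : Formula (4 + n)
        inCertificateᶠ = ∃∈[ 1F ] rename (lift 1 (2 ↑ʳ_)) certificateᶠ ∧ 1F ∈ 0F
        old : Subset t (λ p → ⟦ inCertificateᶠ ⟧ (p ∷ t ∷ params))
        old = Δ₀ᴾ-separation (∃∈ 1F (and (Δ₀ᴾ-rename _ certificate-Δ₀ᴾ) (mem 1F 0F))) (t ∷ params) t
        h⁺ = set old ∪ ⟨ q , q ⟩
        q∈h⁺ : q ε h⁺
        q∈h⁺ = ∈-∪ʳ (∈-pairˡ q q)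
        ⊑h⁺ : ∀ {h} → h ε t → Certificate h → h ⊑ h⁺
        ⊑h⁺ {h} h∈t c p p∈h = ∈-∪ˡ (into old (t-tr h h∈t p p∈h)
          (h , h∈t , ⟦rename⟧ _ {h ∷ params} {h ∷ p ∷ t ∷ params} certificateᶠ
            (lookup-lift₁ λ _ → refl) (certificate⇒ c) , p∈h))
        entry⁺ : Entry W x h⁺
        entry⁺ = lW , level-transitive lW _ xy₀∈W y₀ (∈-pairʳ _ _) , λ z z∈x →
          let h , h∈S , r = proj₂ collected z z∈x
              c , p , p∈h , z∈p , W′ , W′∈p , z∈W′ = reaches⇐ r
              h∈t = S⊑t h h∈S
              W′⊑t = t-tr W′ (t-tr p (t-tr h h∈t p p∈h) W′ W′∈p)
          in p , ⊑h⁺ h∈t c p p∈h , z∈p , W′ , W′∈p , z∈W′ , λ u u∈X (y , y⊑W′ , s) →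
             let u′ , u′∈u , y′ , y′⊑C , s′ =
                   proj₂ (step-exists t) u u∈X (y , (λ v v∈y → W′⊑t v (y⊑W′ v v∈y)) , s)
             in u′ , u′∈u , y′ , (λ v v∈y′ → level-transitive lW C C∈W v (y′⊑C v v∈y′)) , s′
        W∉W : W ε W → 𝔽
        W∉W = irreflexive W
        cert⁺ : Certificate h⁺
        cert⁺ p p∈h⁺ x′ x′∈p W″ W″∈p x′∈W″ =
          entry⇐ (stable entryᶠ (W″ ∷ x′ ∷ h⁺ ∷ params) λ no → ∈-∪⁻ p∈h⁺
            (λ p∈old → let h , h∈t , c , p∈h = out old p∈old
                           c′ = certificate⇐ (⟦rename⟧⁻ _ {h ∷ params} {h ∷ p ∷ t ∷ params}
                                  certificateᶠ (lookup-lift₁ λ _ → refl) c)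
                       in no (entry⇒ (entry-mono (⊑h⁺ h∈t c′) (c′ p p∈h x′ x′∈p W″ W″∈p x′∈W″))))
            (λ p∈qq → ∈-pair⁻ p∈qq (new no) (new no)))
          where
          -- Of the four readings of `q` as a pair only `(x,W)` survives. The others give `x ε x`,
          -- `W ε W`, or `W ε x` together with `x ε W`, against Foundation.
          new : (⟦ entryᶠ ⟧ (W″ ∷ x′ ∷ h⁺ ∷ params) → 𝔽) → p ≈ q → 𝔽
          new no p≈q = ∈-pair⁻ (≈-subst (1F ∈ 0F) (x′ ∷ []) p≈q x′∈p)
            (λ x′≈x → ∈-pair⁻ W″∈q
              (λ W″≈x → irreflexive x (≈-subst₂ (0F ∈ 1F) [] x′≈x W″≈x x′∈W″))
              (λ W″≈W → no (≈-subst₂ entryᶠ (h⁺ ∷ params)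
                (≈-sym W″≈W) (≈-sym x′≈x) (entry⇒ entry⁺))))
            (λ x′≈W → ∈-pair⁻ W″∈q
              (λ W″≈x → W∉W (level-transitive lW x x∈W W (≈-subst₂ (0F ∈ 1F) [] x′≈W W″≈x x′∈W″)))
              (λ W″≈W → W∉W (≈-subst₂ (0F ∈ 1F) [] x′≈W W″≈W x′∈W″)))
            where
            W″∈q = ≈-subst (1F ∈ 0F) (W″ ∷ []) p≈q W″∈p

    -- The limit level and the contradiction

    module Limit
      (I i₀ : D) (i₀∈I : i₀ ε I) (succ : ∀ x → x ε I → Σ[ y ∈ D ] y ε I × x ε y)
      (h : D) (cert : Certificate h)
      (reached : ∀ x → x ε I → Σ[ p ∈ D ] p ε h × x ε p × Σ[ W ∈ D ] W ε p × x ε W)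
      where
      Covers : D → Set
      Covers C = ∀ x → x ε I → Σ[ W ∈ D ] W ε C × Σ[ p ∈ D ] p ε h × x ε p × W ε p × x ε W

      coversᶠ : Formula 3
      coversᶠ = ∀∈[ 1F ] ∃∈[ 1F ] ∃∈[ 4F ] 2F ∈ 0F ∧ 1F ∈ 0F ∧ 2F ∈ 1F

      covers-Δ₀ᴾ : Δ₀ᴾ coversᶠ
      covers-Δ₀ᴾ = ∀∈ 1F (∃∈ 1F (∃∈ 4F (and (mem 2F 0F) (and (mem 1F 0F) (mem 2F 1F)))))

      some-level : Σ[ C ∈ D ] Level C × Covers C
      some-level = C , lC , λ x x∈I →
        let p , p∈h , x∈p , W , W∈p , x∈W = reached x x∈I
        in W , tr p (tr h h∈C p p∈h) W W∈p , p , p∈h , x∈p , W∈p , x∈W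
        where
        above = level-⊒ ⟨ h , h ⟩
        C = proj₁ above
        lC = proj₁ (proj₂ above)
        tr = level-transitive lC
        h∈C = proj₂ (proj₂ above) h (∈-pairˡ h h)

      no-least-cover : (Σ[ C ∈ D ] Level C × Covers C × (∀ V → V ε C → Level V → Covers V → 𝔽)) → 𝔽
      no-least-cover (C , lC , covers , least) =
        let x , (x∈X , y , y∈C , t) , minimal = Π₁ᴾ-foundation (base witnessed-Δ₀ᴾ) (X ∷ C ∷ ρ)
              (x₀ , x₀∈X , y₀ , y₀∈C , ⟦rename⟧ _ ψ (lookup-lift₂ λ _ → refl) ψ₀)
            V , V∈C , lV , y⊑V = level-below lC y y∈C
        -- `V` is now shown to cover `I` as well, against the minimality of `C`.
        in least V V∈C lV λ u u∈I →
          -- Going back from `u⁺` to `u` yields a step out of `W₂` that ends at `W₁`, a member of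
          -- `C`.
          let u⁺ , u⁺∈I , u∈u⁺ = succ u u∈I
              W₁ , W₁∈C , p₁ , p₁∈h , u⁺∈p₁ , W₁∈p₁ , u⁺∈W₁ = covers u⁺ u⁺∈I
              _ , _ , back = cert p₁ p₁∈h u⁺ u⁺∈p₁ W₁ W₁∈p₁ u⁺∈W₁
              p₂ , p₂∈h , u∈p₂ , W₂ , W₂∈p₂ , u∈W₂ , step = back u u∈u⁺
              lW₂ , _ = cert p₂ p₂∈h u u∈p₂ W₂ W₂∈p₂ u∈W₂
              -- Otherwise `y ⊑ V ⊑ W₂`, and the step produces `x′ ε x` with a witness included in
              -- `W₁` and hence in `C`, against the minimality of `x`.
              W₂∈V = stable (0F ∈ 1F) (W₂ ∷ V ∷ []) λ W₂∉V →
                let x′ , x′∈x , y′ , y′⊑W₁ , t′ = step x x∈X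
                      (y , (λ z z∈y → comparable lV lW₂ W₂∉V z (y⊑V z z∈y)) ,
                       ⟦rename⟧⁻ _ ψ (lookup-lift₂ λ _ → refl) t)
                in minimal x′ x′∈x (X-transitive x x∈X x′ x′∈x , y′ ,
                     level-potent lC W₁ W₁∈C y′ y′⊑W₁ ,
                     ⟦rename⟧ _ ψ (lookup-lift₂ λ _ → refl) t′)
          in W₂ , W₂∈V , p₂ , p₂∈h , u∈p₂ , W₂∈p₂ , u∈W₂
        where
        witnessedᶠ : Formula (3 + n)
        witnessedᶠ = 0F ∈ 1F ∧ (∃∈[ 2F ] rename (lift 2 (2 ↑ʳ_)) ψ)
        witnessed-Δ₀ᴾ : Δ₀ᴾ witnessedᶠ
        witnessed-Δ₀ᴾ = and (mem 0F 1F) (∃∈ 2F (Δ₀ᴾ-rename _ δ))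
        y₀∈C : y₀ ε C
        y₀∈C = let W , W∈C , p , p∈h , i₀∈p , W∈p , i₀∈W = covers i₀ i₀∈I
                   _ , y₀∈W , _ = cert p p∈h i₀ i₀∈p W W∈p i₀∈W
               in level-transitive lC W W∈C y₀ y₀∈W

      contradiction : 𝔽
      contradiction =
        no-least-cover (least-level {φ = coversᶠ} covers-Δ₀ᴾ (I ∷ h ∷ []) some-level)

    absurd : 𝔽
    absurd =
      let I , (i₀ , i₀∈I) , succ = unbounded
          h , cert , p , p∈h , I∈p , W , W∈p , I∈W = reach I
          -- The entry for `I` itself supplies a pair in `h` for every element of `I`.
          _ , _ , back = cert p p∈h I I∈p W W∈p I∈W
      in Limit.contradiction I i₀ i₀∈I succ h cert λ x x∈I →
           let p′ , p′∈h , x∈p′ , W′ , W′∈p′ , x∈W′ , _ = back x x∈I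
           in p′ , p′∈h , x∈p′ , W′ , W′∈p′ , x∈W′

-- Once the prefix is contracted to a single quantifier, the absence of an ∈-minimal instance is the
-- hypothesis `descend`.
Σ₁ᴾ-foundation : (𝓜 : Model) → (∀ {τ} → KPᴾ τ → 𝓜 ⊨ τ) →
                 ∀ {n} {φ : Formula (suc n)} → Σ₁ᴾ φ → 𝓜 ⊨ foundation φ
Σ₁ᴾ-foundation 𝓜 valid {n} {φ} s = closure-intro n _ λ ρ (x , t) →
  let ψ , δ , iff = Σ₁ᴾ-contract s
      y , t′ = proj₁ (iff _) t
      descendᶠ = ∃∈[ 0F ] ∃′ rename (lift 2 suc) ψ
  in stable (∃′ (φ ∧ (∀∈[ 0F ] ¬ rename (lift 1 suc) φ))) ρ λ no →
    Descent.Absurdity.absurd 𝓜 valid δ ρ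
      (λ x y t → let x′ , x′∈x , y′ , t′ = stable descendᶠ (x ∷ ρ) λ none →
                       no (x , proj₂ (iff _) (y , t) , λ x′ x′∈x t′ →
                         let y′ , t″ = proj₁ (iff _)
                               (⟦rename⟧⁻ _ {x′ ∷ ρ} {x′ ∷ x ∷ ρ} φ (lookup-lift₁ λ _ → refl) t′)
                         in none (x′ , x′∈x , y′ , ⟦rename⟧ _ ψ (lookup-lift₂ λ _ → refl) t″))
                 in x′ , x′∈x , y′ , ⟦rename⟧⁻ _ ψ (lookup-lift₂ λ _ → refl) t′)
      x y t′
  where open InKPᴾ 𝓜 valid

corollary3p6 : ∀ {σ} → Foundation Σ₁ᴾ σ → KPᴾ ⊢ σ
corollary3p6 (Foundation.inst s) = completeness λ 𝓜 valid → Σ₁ᴾ-foundation 𝓜 valid s
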